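{- Let $G$ be a factorizable graph and $X$ an odd-maximal barrier of $G$. Let $D_1,\ldots,D_k$ be the DM-components of $G_X$ (with respect to $X$), and let $\hat V_1,\ldots,\hat V_k$ be the partition of $X\cup D_X$ such that $\hat D_i:=G[\hat V_i]$ is the expansion of $D_i$ for each $i$. Then for each $i=1,\ldots,k$, the set $S_i:=X\cap\hat V_i$ coincides with a member of $\mathcal{P}_G(H_i)$ for some $H_i\in\mathcal{G}(G)$, and $\hat V_i=U^*(H_i)\setminus U(S_i)$.
   Context: All graphs are finite. A matching is a set of pairwise disjoint edges; perfect if it covers all vertices. A graph is factorizable if it has a perfect matching, factor-critical if deleting any single vertex yields the empty graph or a factorizable graph. For $X\subseteq V(G)$: $G[X]$ induced subgraph, $G-X=G[V(G)\setminus X]$, $G/X$ contraction of $X$ to one vertex (vertices/edges of $G/X$ identified with those of $G$), $\Gamma(X)$ the vertices outside $X$ adjacent to $X$, $E(G[X])$ the edges with both ends in $X$. For factorizable $G$: an edge is allowed if it lies in some perfect matching; for each connected component $C$ of the subgraph formed by allowed edges, $G[V(C)]$ is a factor-component; $\mathcal{G}(G)$ is the set of them. $X$ is separating if each $H\in\mathcal{G}(G)$ has $V(H)\subseteq X$ or $V(H)\cap X=\emptyset$. Barriers: $q_G(X)$ = number of odd components of $G-X$; $X$ is a barrier if $q_G(X)-|X|=|V(G)|-2\nu(G)$ ($\nu$ = maximum matching size). $D_X$ = vertices of odd components of $G-X$, $C_X=V(G)\setminus X\setminus D_X$. A barrier $X$ is odd-maximal if no nonempty $Y\subseteq D_X$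 makes $X\cup Y$ a barrier. Bipartite reduction: if $K_1,\ldots,K_l$ are the odd components of $G-X$, $G_X:=(G-C_X-E(G[X]))/V(K_1)/\cdots/V(K_l)$, a bipartite graph with color classes $X$ and the contracted vertices. For a bipartite factorizable graph with color classes $A,B$, its DM-components are its factor-components, and $\le_A$ (the Dulmage–Mendelsohn order) is the reflexive–transitive closure of the relation $\{(G_j,G_i): \text{some edge joins } B\cap V(G_j) \text{ and } A\cap V(G_i)\}$; this is a partial order. The DM-decomposition of $G_X$ is taken with respect to $A=X$. The expansion of a DM-component $D$ of $G_X$ is the subgraph of $G$ induced by $(V(D)\cap X)\cup\bigcup V(K_i)$, the union over the odd components $K_i$ whose contracted vertex lies in $D$. Cathedral structure: $G_1\trianglelefteq G_2$ (for $G_1,G_2\in\mathcal{G}(G)$) if there is a separating $X\supseteq V(G_1)\cup V(G_2)$ with $G[X]/V(G_1)$ factor-critical (a partial order). $u\sim_G v$ if $u,v$ are in the same factor-component and $G-u-v$ is not factorizable (an equivalence relation); $\mathcal{P}(G)$ is its set of classes and $\mathcal{P}_G(H)=\{S\in\mathcal{P}(G):S\subseteq V(H)\}$. $U^*(H)=\bigcup\{V(H'):H\trianglelefteq H'\}$, $U(H)=U^*(H)\setminus V(H)$. For $S\in\mathcal{P}_G(H)$, $U(S)$ is the union of $V(H')$ over all $H'\in\mathcal{G}(G)$ with $H\trianglelefteq H'$, $H'\ne H$, such that some connected component $K$ of $G[U(H)]$ satisfies $\Gamma(K)\cap V(H)\subseteq S$ and $V(H')\subseteq V(K)$; $U^*(S)=U(S)\cup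 S$. -}

module Defs where

open import Level using (0ℓ)
open import Data.Nat using (ℕ; _+_; _*_; _≤_; _%_)
open import Data.Bool using (Bool; true; false; T)
open import Data.Fin using (Fin)
open import Data.Fin.Subset using (Subset; _∈_; _∉_; _∪_; _⊆_; Nonempty; ∣_∣)
open import Data.List using (List; []; _∷_; length; concatMap; lookup)
open import Data.List.Relation.Unary.All using (All)
open import Data.List.Relation.Unary.Unique.Propositional using (Unique)
import Data.List.Membership.Propositional as LM
open import Data.Product using (Σ; ∃; _×_; _,_; proj₁; proj₂)
open import Data.Sum using (_⊎_; inj₁; inj₂)
open import Data.Unit using (⊤; tt)
open import Data.Empty using (⊥)
open import Relation.Nullary using (¬_)
open import Relation.Binary.PropositionalEquality using (_≡_; _≢_)
open import Relation.Binary.Construct.Closure.ReflexiveTransitive using (Star)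
open import Function.Bundles using (_⇔_)

record Gr : Set₁ where
  field
    V : Set
    E : V → V → Set
open Gr public

Induce : (G : Gr) → (V G → Set) → Gr
Induce G P = record { V = Σ (V G) P ; E = λ a b → E G (proj₁ a) (proj₁ b) }

Contract : (G : Gr) → (V G → Set) → Gr
Contract G P = record { V = Σ (V G) (λ v → ¬ P v) ⊎ ⊤ ; E = e }
  where
  e : Σ (V G) (λ v → ¬ P v) ⊎ ⊤ → Σ (V G) (λ v → ¬ P v) ⊎ ⊤ → Set
  e (inj₁ a) (inj₁ b) = E G (proj₁ a) (proj₁ b)
  e (inj₁ a) (inj₂ _) = Σ (V G) λ w → P w × E G (proj₁ a) w
  e (inj₂ _) (inj₁ b) = Σ (V G) λ w → P w × E G w (proj₁ b)
  e (inj₂ _) (inj₂ _) = ⊥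

ends : {A : Set} → List (A × A) → List A
ends = concatMap (λ e → proj₁ e ∷ proj₂ e ∷ [])

IsMatching : (G : Gr) → List (V G × V G) → Set
IsMatching G M = All (λ e → E G (proj₁ e) (proj₂ e)) M × Unique (ends M)

PerfectMatching : Gr → Set
PerfectMatching G =
  Σ (List (V G × V G)) λ M → IsMatching G M × (∀ v → v LM.∈ ends M)

Factorizable : Gr → Set
Factorizable G = PerfectMatching G

FactorCritical : Gr → Set
FactorCritical G =
  ∀ w → (∀ v → v ≡ w) ⊎ Factorizable (Induce G (λ v → v ≢ w))

Allowed : (G : Gr) → V G → V G → Set
Allowed G u v = Σ (PerfectMatching G) λ M →
  ((u , v) LM.∈ proj₁ M) ⊎ ((v , u) LM.∈ proj₁ M)

-- FC G r v : v lies in the factor-component containing r, i.e. in the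
-- connected component of r in the subgraph formed by the allowed edges.
-- Each factor-component is represented by any of its vertices r.
FC : (G : Gr) → V G → V G → Set
FC G = Star (Allowed G)

record Graph (n : ℕ) : Set where
  field
    adj    : Fin n → Fin n → Bool
    sym    : ∀ u v → adj u v ≡ adj v u
    irrefl : ∀ v → adj v v ≡ false
open Graph public

⟦_⟧ : ∀ {n} → Graph n → Gr
⟦_⟧ {n} G = record { V = Fin n ; E = λ u v → T (adj G u v) }

module _ {n : ℕ} (G : Graph n) where

  IsNu : ℕ → Set
  IsNu k = (Σ (List (Fin n × Fin n)) λ M → IsMatching ⟦ G ⟧ M × length M ≡ k)
         × (∀ M → IsMatching ⟦ G ⟧ M → length M ≤ k)

  IsComp : Subset n → Subset n → Set
  IsComp X C = (∀ v → v ∈ C → v ∉ X)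
             × Nonempty C
             × (∀ u v → u ∈ C → v ∈ C →
                  Star (λ a b → a ∈ C × b ∈ C × T (adj G a b)) u v)
             × (∀ u v → u ∈ C → v ∉ X → T (adj G u v) → v ∈ C)

  Odd : ℕ → Set
  Odd m = m % 2 ≡ 1

  OddComps : Subset n → List (Subset n) → Set
  OddComps X Ks = Unique Ks × (∀ C → (C LM.∈ Ks) ⇔ (IsComp X C × Odd ∣ C ∣))

  DX : Subset n → Fin n → Set
  DX X v = Σ (Subset n) λ C → IsComp X C × Odd ∣ C ∣ × v ∈ C

  -- barrier: q_G(X) - |X| = |V(G)| - 2 ν(G)
  Barrier : Subset n → Set
  Barrier X = Σ ℕ λ k → IsNu k × Σ (List (Subset n)) λ Ks →
    OddComps X Ks × length Ks + 2 * k ≡ n + ∣ X ∣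

  OddMaximal : Subset n → Set
  OddMaximal X = Barrier X ×
    (∀ Y → (∀ v → v ∈ Y → DX X v) → Nonempty Y → ¬ Barrier (X ∪ Y))

  -- Bipartite reduction G_X (Ks = the odd components K_1 … K_l)

  GX : Subset n → List (Subset n) → Gr
  GX X Ks = record { V = Σ (Fin n) (λ x → x ∈ X) ⊎ Fin (length Ks) ; E = e }
    where
    e : Σ (Fin n) (λ x → x ∈ X) ⊎ Fin (length Ks) →
        Σ (Fin n) (λ x → x ∈ X) ⊎ Fin (length Ks) → Set
    e (inj₁ a) (inj₂ j) = Σ (Fin n) λ w → w ∈ lookup Ks j × T (adj G (proj₁ a) w)
    e (inj₂ j) (inj₁ a) = Σ (Fin n) λ w → w ∈ lookup Ks j × T (adj G (proj₁ a) w)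
    e (inj₁ _) (inj₁ _) = ⊥
    e (inj₂ _) (inj₂ _) = ⊥

  -- vertex set V̂ of the expansion of the DM-component of G_X containing d
  Expansion : (X : Subset n) (Ks : List (Subset n)) → V (GX X Ks) → Fin n → Set
  Expansion X Ks d v =
    (Σ (v ∈ X) λ p → FC (GX X Ks) d (inj₁ (v , p)))
    ⊎ (Σ (Fin (length Ks)) λ j → FC (GX X Ks) d (inj₂ j) × v ∈ lookup Ks j)

  -- Cathedral structure (factor-components represented by vertices)

  FCG : Fin n → Fin n → Set
  FCG = FC ⟦ G ⟧

  Separating : Subset n → Set
  Separating Y = ∀ r → (∀ v → FCG r v → v ∈ Y) ⊎ (∀ v → FCG r v → v ∉ Y)

  _⊴_ : Fin n → Fin n → Set
  r ⊴ s = Σ (Subset n) λ Y → Separating Y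
        × (∀ v → FCG r v → v ∈ Y) × (∀ v → FCG s v → v ∈ Y)
        × FactorCritical (Contract (Induce ⟦ G ⟧ (λ v → v ∈ Y))
                                   (λ w → FCG r (proj₁ w)))

  Sim : Fin n → Fin n → Set
  Sim u v = FCG u v × ¬ Factorizable (Induce ⟦ G ⟧ (λ w → w ≢ u × w ≢ v))

  InP : Fin n → (Fin n → Set) → Set
  InP r S = (Σ (Fin n) λ u → ∀ v → S v ⇔ Sim u v) × (∀ v → S v → FCG r v)

  UStar : Fin n → Fin n → Set
  UStar r v = Σ (Fin n) λ s → r ⊴ s × FCG s v

  UH : Fin n → Fin n → Set
  UH r v = UStar r v × ¬ FCG r v

  CompU : Fin n → Fin n → Fin n → Set
  CompU r k w = Star (λ a b → UH r a × UH r b × T (adj G a b)) k w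

  USet : Fin n → (Fin n → Set) → Fin n → Set
  USet r S v = Σ (Fin n) λ s → r ⊴ s × ¬ FCG r s
    × (Σ (Fin n) λ k → UH r k
        × (∀ w → ¬ CompU r k w → (Σ (Fin n) λ y → CompU r k y × T (adj G y w))
                 → FCG r w → S w)
        × (∀ w → FCG s w → CompU r k w))
    × FCG s v

{-# OPTIONS --safe #-}

-- Every odd component K j of G - X is factor-critical: otherwise a Tutte-Berge set of K j - v,
-- together with v, would extend the odd-maximal barrier X. So with a perfect matching M fixed
-- and σ j the vertex of X that M matches into K j, the DM-components of G_X are the strong
-- components of the digraph with an arrow j → k when K j is adjacent to σ k: a path from k to j
-- reroutes M to a perfect matching of G - σ k - v for any v in K j. Let S be the part of X in one
-- strong component and V̂ its expansion. Then S lies in one factor-component H, V̂ is closed under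
-- allowed edges, and rerouting shows that S is a class of H. The contraction G[V̂] / H is
-- factor-critical since the symmetric difference of M and a perfect matching of K j - v contains an
-- alternating path from v to H. Conversely, if H ⊴ H′ with H′ outside V̂ were joined to a
-- vertex of H not in S, some x = σ k outside V̂ with H ⊴ (component of x) would be adjacent to a
-- K j inside V̂; the alternating path from x to H that factor-criticality provides follows
-- arrows, so k would be strongly connected to j.

module Submission where

open import Defs
open import Data.Nat using (ℕ; zero; suc; _+_; _*_; _≤_; _<_; z≤n; s≤s; _%_; _≤?_)
open import Data.Nat.Properties using (≤-pred; n≤0⇒n≡0; *-monoʳ-≤; m≤n⇒∃[o]m+o≡n; ≤-refl; ≤-trans;
  ≤-antisym; ≤-reflexive; ≤-<-trans; n<1+n; n≤1+n; m≤n⇒m<n∨m≡n; +-suc; +-comm; +-identityʳ; m≤n+m;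
  +-monoˡ-≤; +-monoʳ-≤; +-mono-≤; +-cancelˡ-≤; +-cancelʳ-≡; ≮⇒≥; ≰⇒>; <⇒≱; module ≤-Reasoning)
open import Data.Bool using (Bool; T)
open import Data.Bool.Properties using (T?)
open import Data.Fin using (Fin; zero; suc; toℕ)
open import Data.Fin.Properties using (_≟_; toℕ-injective; toℕ<n; any?; all?; pigeonhole) renaming
  (suc-injective to Fsuc-injective)
open import Data.Fin.Subset using (Subset; _∈_; _∉_; _⊆_; _∪_; _-_; _─_; ⁅_⁆; ∣_∣; Nonempty;
  inside; outside) renaming (⊤ to full; ⊥ to ∅)
open import Data.Fin.Subset.Properties using (_∈?_; ⊆-antisym; x∈p⇒∣p-x∣<∣p∣; x∈p∧x≢y⇒x∈p-y;
  x∈⁅x⁆; p─q⊆p; p⊆q⇒∣p∣≤∣q∣; nonempty?; anySubset?; ∣p∣≤n; ∣⊤∣≡n; ∈⊤; x∈p∪q⁺; x∈p∪q⁻; ∉⊥; ∣⊥∣≡0)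
open import Data.Vec using ([]; _∷_; tabulate)
open import Data.Vec.Base using (here; there)
open import Data.Vec.Properties using (lookup∘tabulate; []=⇒lookup; lookup⇒[]=; ≡-dec)
open import Data.List using (List; []; _∷_; length; map; _++_; filter; lookup; allFin)
open import Data.List.Properties using (length-map; length-++; length-tabulate)
open import Data.List.Relation.Unary.All using (All; []; _∷_)
import Data.List.Relation.Unary.All as All
import Data.List.Relation.Unary.All.Properties as AllP
open import Data.List.Relation.Unary.Any using (Any; here; there)
import Data.List.Relation.Unary.Any as Any
open import Data.List.Relation.Unary.AllPairs using ([]; _∷_)
open import Data.List.Relation.Unary.Unique.Propositional using (Unique)
import Data.List.Relation.Unary.Unique.Propositional.Properties as UP
import Data.List.Membership.Propositional as LM
import Data.List.Membership.Propositional.Properties as LMP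
open import Data.Product using (Σ; _×_; _,_; proj₁; proj₂)
open import Data.Sum using (_⊎_; inj₁; inj₂; [_,_]′)
import Data.Sum.Properties as SumP
open import Data.Unit using (⊤; tt)
open import Data.Empty using (⊥; ⊥-elim)
open import Relation.Nullary using (¬_; Dec; yes; no; does; contradiction)
open import Relation.Nullary.Decidable using (_×-dec_; _→-dec_; _⊎-dec_; ¬?; map′; dec-true;
  decidable-stable)
open import Relation.Binary.PropositionalEquality using (_≡_; _≢_; refl; trans; cong; cong₂;
  subst; subst₂) renaming (sym to ≡-sym)
open import Relation.Binary.Construct.Closure.ReflexiveTransitive using (Star; ε; _◅_; _◅◅_)
open import Relation.Binary using (DecidableEquality)
open import Function.Base using (_∘_; id)
open import Function.Bundles using (_⇔_; mk⇔; module Equivalence)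

-- Finite sets, reachability and injections

-- The digraph mediates between `G` and `G_X`, whose allowed edges both quantify over perfect
-- matchings. Arrow paths produce matchings by rerouting. Conversely, a perfect matching of either
-- graph sends each index `j` to the `k` for which it joins `K j` to `σ k`; this is a permutation
-- whose steps are arrows, and the cycles of a permutation bring every step back. So an edge between
-- `K j` and `σ k` is allowed exactly when `j` and `k` are strongly connected, although `σ` was read
-- off from one matching. The obstacle is that `G_X` forgets at which vertex an edge enters `K j`.
-- Two allowed edges may meet `K j` at different vertices, and only a parity count inside `K j`
-- shows that these share a factor-component of `G`. It follows that `H` meets every `K j` of the
-- expansion, namely in `exitOf j`. This also separates the expansion from `U(S)`: a component of
-- `G[U(H)]` containing a vertex of `K j` is then adjacent to a vertex of `H` outside `X`, hence
-- outside `S`.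

module _ {n : ℕ} where

  abstract
    ⟪_⟫ : {P : Fin n → Set} → (∀ v → Dec (P v)) → Subset n
    ⟪ P? ⟫ = tabulate (does ∘ P?)

    ∈⟪⟫⁺ : {P : Fin n → Set} (P? : ∀ v → Dec (P v)) {v : Fin n} → P v → v ∈ ⟪ P? ⟫
    ∈⟪⟫⁺ P? {v} pv = lookup⇒[]= v _ (trans (lookup∘tabulate (does ∘ P?) v) (dec-true (P? v) pv))

    ∈⟪⟫⁻ : {P : Fin n → Set} (P? : ∀ v → Dec (P v)) {v : Fin n} → v ∈ ⟪ P? ⟫ → P v
    ∈⟪⟫⁻ P? {v} v∈ with P? v | trans (≡-sym (lookup∘tabulate (does ∘ P?) v)) ([]=⇒lookup v∈)
    ... | yes pv | _ = pv
    ... | no _   | ()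

x∈p─q⇒x∉q : ∀ {n} (p q : Subset n) {x} → x ∈ p ─ q → x ∉ q
x∈p─q⇒x∉q (_ ∷ p) (inside ∷ q) (there x∈) (there x∈q) = x∈p─q⇒x∉q p q x∈ x∈q
x∈p─q⇒x∉q (_ ∷ p) (outside ∷ q) (there x∈) (there x∈q) = x∈p─q⇒x∉q p q x∈ x∈q

module _ {n : ℕ} {p : Subset n} {x y : Fin n} where

  x∈p-y⇒x∈p : x ∈ p - y → x ∈ p
  x∈p-y⇒x∈p = p─q⊆p p ⁅ y ⁆

  x∈p-y⇒x≢y : x ∈ p - y → x ≢ y
  x∈p-y⇒x≢y x∈ refl = x∈p─q⇒x∉q p ⁅ y ⁆ x∈ (x∈⁅x⁆ y)

elems : ∀ {n} → Subset n → List (Fin n)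
elems [] = []
elems (inside ∷ p) = zero ∷ map suc (elems p)
elems (outside ∷ p) = map suc (elems p)

length-elems : ∀ {n} (p : Subset n) → length (elems p) ≡ ∣ p ∣
length-elems [] = refl
length-elems (inside ∷ p) = cong suc (trans (length-map suc (elems p)) (length-elems p))
length-elems (outside ∷ p) = trans (length-map suc (elems p)) (length-elems p)

elems-unique : ∀ {n} (p : Subset n) → Unique (elems p)
elems-unique [] = []
elems-unique (inside ∷ p) = AllP.map⁺ (All.universal (λ _ ()) (elems p)) ∷ UP.map⁺ Fsuc-injective (elems-unique p)
elems-unique (outside ∷ p) = UP.map⁺ Fsuc-injective (elems-unique p)

∈-elems⁺ : ∀ {n} {p : Subset n} {x} → x ∈ p → x LM.∈ elems p
∈-elems⁺ {p = inside ∷ p} here = here refl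
∈-elems⁺ {p = inside ∷ p} (there x∈) = there (LMP.∈-map⁺ suc (∈-elems⁺ x∈))
∈-elems⁺ {p = outside ∷ p} (there x∈) = LMP.∈-map⁺ suc (∈-elems⁺ x∈)

∈-elems⁻ : ∀ {n} {p : Subset n} {x} → x LM.∈ elems p → x ∈ p
∈-elems⁻ {p = inside ∷ p} (here refl) = here
∈-elems⁻ {p = inside ∷ p} (there x∈) with LMP.∈-map⁻ suc x∈
... | _ , y∈ , refl = there (∈-elems⁻ y∈)
∈-elems⁻ {p = outside ∷ p} x∈ with LMP.∈-map⁻ suc x∈
... | _ , y∈ , refl = there (∈-elems⁻ y∈)

unique-⊆⇒length≤ : {A : Set} {xs ys : List A} → Unique xs → (∀ {x} → x LM.∈ xs → x LM.∈ ys) → length xs ≤ length ys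
unique-⊆⇒length≤ [] _ = z≤n
unique-⊆⇒length≤ {xs = x ∷ xs} (x∉ ∷ u) xs⊆ with LMP.∈-∃++ (xs⊆ (here refl))
... | as , bs , refl = begin
  suc (length xs)               ≤⟨ s≤s (unique-⊆⇒length≤ u xs⊆′) ⟩
  suc (length (as ++ bs))       ≡⟨ cong suc (length-++ as) ⟩
  suc (length as + length bs)   ≡⟨ +-suc (length as) (length bs) ⟨
  length as + length (x ∷ bs)   ≡⟨ length-++ as ⟨
  length (as ++ x ∷ bs)         ∎
  where
  open ≤-Reasoning
  xs⊆′ : ∀ {y} → y LM.∈ xs → y LM.∈ as ++ bs
  xs⊆′ y∈ with LMP.∈-++⁻ as (xs⊆ (there y∈))
  ... | inj₁ y∈as = LMP.∈-++⁺ˡ y∈as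
  ... | inj₂ (here refl) = contradiction refl (All.lookup x∉ y∈)
  ... | inj₂ (there y∈bs) = LMP.∈-++⁺ʳ as y∈bs

module _ {n : ℕ} where

  unique-⊆⇒length≤∣∣ : {xs : List (Fin n)} {p : Subset n} → Unique xs → (∀ {x} → x LM.∈ xs → x ∈ p) → length xs ≤ ∣ p ∣
  unique-⊆⇒length≤∣∣ {p = p} u xs⊆ =
    ≤-trans (unique-⊆⇒length≤ u (∈-elems⁺ ∘ xs⊆)) (≤-reflexive (length-elems p))

  ∣∣≤length : {xs : List (Fin n)} {p : Subset n} → (∀ {x} → x ∈ p → x LM.∈ xs) → ∣ p ∣ ≤ length xs
  ∣∣≤length {p = p} p⊆ =
    ≤-trans (≤-reflexive (≡-sym (length-elems p))) (unique-⊆⇒length≤ (elems-unique p) (p⊆ ∘ ∈-elems⁻))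

  ∣p∣≤1+∣q∣ : {p q : Subset n} {x : Fin n} → (∀ {y} → y ∈ p → y ≢ x → y ∈ q) → ∣ p ∣ ≤ suc ∣ q ∣
  ∣p∣≤1+∣q∣ {p} {q} {x} p-x⊆q = ≤-trans (∣∣≤length p⊆) (s≤s (≤-reflexive (length-elems q)))
    where
    p⊆ : ∀ {y} → y ∈ p → y LM.∈ x ∷ elems q
    p⊆ {y} y∈ with y ≟ x
    ... | yes refl = here refl
    ... | no y≢x = there (∈-elems⁺ (p-x⊆q y∈ y≢x))

  ∣p∣<∣q∣ : {p q : Subset n} {x : Fin n} → (∀ {y} → y ∈ p → y ∈ q) → x ∈ q → x ∉ p → ∣ p ∣ < ∣ q ∣
  ∣p∣<∣q∣ {p} {q} {x} p⊆q x∈q x∉p =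
    ≤-<-trans (p⊆q⇒∣p∣≤∣q∣ {p = p} {q - x} (λ {y} y∈ → x∈p∧x≢y⇒x∈p-y (p⊆q y∈) λ { refl → x∉p y∈ })) (x∈p⇒∣p-x∣<∣p∣ {p = q} x∈q)

  suc∣p∣≡∣q∣ : {p q : Subset n} {x : Fin n} → (∀ {y} → y ∈ p → y ∈ q) → x ∈ q → x ∉ p →
               (∀ {y} → y ∈ q → y ≢ x → y ∈ p) → suc ∣ p ∣ ≡ ∣ q ∣
  suc∣p∣≡∣q∣ p⊆q x∈q x∉p q-x⊆p = ≤-antisym (∣p∣<∣q∣ p⊆q x∈q x∉p) (∣p∣≤1+∣q∣ q-x⊆p)

  suc∣p-x∣≡∣p∣ : {p : Subset n} {x : Fin n} → x ∈ p → suc ∣ p - x ∣ ≡ ∣ p ∣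
  suc∣p-x∣≡∣p∣ x∈p = suc∣p∣≡∣q∣ x∈p-y⇒x∈p x∈p (λ x∈ → x∈p-y⇒x≢y x∈ refl) x∈p∧x≢y⇒x∈p-y

  maximum-subset : {Q : Subset n → Set} → (∀ p → Dec (Q p)) → Σ (Subset n) Q →
                   Σ (Subset n) λ p → Q p × (∀ q → Q q → ∣ q ∣ ≤ ∣ p ∣)
  maximum-subset {Q} Q? (p₀ , qp₀) = go n p₀ qp₀ (m≤n+m n ∣ p₀ ∣)
    where
    -- The fuel `k` bounds how far the size can still rise.
    go : ∀ k p → Q p → n ≤ ∣ p ∣ + k → Σ (Subset n) λ p′ → Q p′ × (∀ q → Q q → ∣ q ∣ ≤ ∣ p′ ∣)
    go zero p qp n≤ = p , qp , λ q _ → ≤-trans (∣p∣≤n q) (≤-trans n≤ (≤-reflexive (+-identityʳ ∣ p ∣)))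
    go (suc k) p qp n≤ with anySubset? (λ q → Q? q ×-dec (suc ∣ p ∣ ≤? ∣ q ∣))
    ... | yes (q , qq , p<q) = go k q qq (≤-trans n≤ (≤-trans (≤-reflexive (+-suc ∣ p ∣ k)) (+-monoˡ-≤ k p<q)))
    ... | no ¬∃ = p , qp , λ q qq → ≮⇒≥ (λ p<q → ¬∃ (q , qq , p<q))

-- Warshall's algorithm: paths with all inner vertices of index below k.
module _ {m : ℕ} {R : Fin m → Fin m → Set} (R? : ∀ u v → Dec (R u v)) where

  private
    W : ℕ → Fin m → Fin m → Set
    W zero u v = u ≡ v ⊎ R u v
    W (suc k) u v = W k u v ⊎ Σ (Fin m) λ c → toℕ c ≡ k × W k u c × W k c v

    W? : ∀ k u v → Dec (W k u v)
    W? zero u v = (u ≟ v) ⊎-dec R? u v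
    W? (suc k) u v = W? k u v ⊎-dec any? λ c → (toℕ c Data.Nat.≟ k) ×-dec (W? k u c ×-dec W? k c v)

    W-sound : ∀ k {u v} → W k u v → Star R u v
    W-sound zero (inj₁ refl) = ε
    W-sound zero (inj₂ r) = r ◅ ε
    W-sound (suc k) (inj₁ w) = W-sound k w
    W-sound (suc k) (inj₂ (_ , _ , a , b)) = W-sound k a ◅◅ W-sound k b

    -- Cutting at the first visit to the vertex of index `k` removes it from the inner vertices of a
    -- walk that ends there. `W-from` is the mirror image.
    W-to : ∀ k {u c} → toℕ c ≡ k → W (suc k) u c → W k u c
    W-to k _ (inj₁ w) = w
    W-to k c≡k (inj₂ (c′ , c′≡k , a , _)) rewrite toℕ-injective (trans c≡k (≡-sym c′≡k)) = a

    W-from : ∀ k {c v} → toℕ c ≡ k → W (suc k) c v → W k c v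
    W-from k _ (inj₁ w) = w
    W-from k c≡k (inj₂ (c′ , c′≡k , _ , b)) rewrite toℕ-injective (trans c≡k (≡-sym c′≡k)) = b

    -- The junction `c` becomes an inner vertex of the joined walk, hence the bound on its index.
    W-trans : ∀ k {u c v} → toℕ c < k → W k u c → W k c v → W k u v
    W-trans (suc k) {c = c} (s≤s c≤k) p q with m≤n⇒m<n∨m≡n c≤k
    ... | inj₂ c≡k = inj₂ (c , c≡k , W-to k c≡k p , W-from k c≡k q)
    ... | inj₁ c<k with p | q
    ...   | inj₁ a | inj₁ b = inj₁ (W-trans k c<k a b)
    ...   | inj₁ a | inj₂ (e , e≡k , b , b′) = inj₂ (e , e≡k , W-trans k c<k a b , b′)
    ...   | inj₂ (e , e≡k , a , a′) | inj₁ b = inj₂ (e , e≡k , a , W-trans k c<k a′ b)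
    -- Both halves visit the vertex of index `k`; everything between the two visits, `c` included,
    -- is dropped.
    ...   | inj₂ (e , e≡k , a , _) | inj₂ (f , f≡k , _ , b) rewrite toℕ-injective (trans f≡k (≡-sym e≡k)) = inj₂ (e , e≡k , a , b)

    W-lift : ∀ k {u v} → W zero u v → W k u v
    W-lift zero w = w
    W-lift (suc k) w = inj₁ (W-lift k w)

    W-complete : ∀ {u v} → Star R u v → W m u v
    W-complete ε = W-lift m (inj₁ refl)
    W-complete (r ◅ rs) = W-trans m (toℕ<n _) (W-lift m (inj₂ r)) (W-complete rs)

  abstract
    star? : ∀ u v → Dec (Star R u v)
    star? u v = map′ (W-sound m) W-complete (W? m u v)

module _ {l : ℕ} (f : Fin l → Fin l) (f-inj : ∀ {a b} → f a ≡ f b → a ≡ b) where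

  private
    it : ℕ → Fin l → Fin l
    it zero x = x
    it (suc k) x = f (it k x)

    it-cancel : ∀ a d {x} → it a x ≡ it (a + d) x → x ≡ it d x
    it-cancel zero d eq = eq
    it-cancel (suc a) d eq = it-cancel a d (f-inj eq)

    orbit : ∀ d x → Star (λ a b → f a ≡ b) (f x) (it (suc d) x)
    orbit zero x = ε
    orbit (suc d) x = orbit d x ◅◅ (refl ◅ ε)

  -- Two of the iterates `f^0 x, ..., f^l x` coincide by pigeonhole, and cancelling the common
  -- applications of `f` leaves a cycle through `x` itself. The path starts at `f x` because it
  -- serves as the way back for the step from `x` to `f x`.
  injection-returns : ∀ x → Star (λ a b → f a ≡ b) (f x) x
  injection-returns x with pigeonhole (n<1+n l) (λ i → it (toℕ i) x)
  ... | i , j , i<j , eq with m≤n⇒∃[o]m+o≡n i<j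
  ...   | d , j≡ = subst (Star _ (f x)) (≡-sym (it-cancel (toℕ i) (suc d)
            (trans eq (cong (λ k → it k x) (trans (≡-sym j≡) (≡-sym (+-suc (toℕ i) d))))))) (orbit d x)

-- Matchings of vertex sets

module Matchings {n : ℕ} (G : Graph n) where

  infix 4 _~_
  _~_ : Fin n → Fin n → Set
  u ~ v = T (adj G u v)

  ~-sym : ∀ {u v} → u ~ v → v ~ u
  ~-sym {u} {v} = subst T (sym G u v)

  ~-irrefl : ∀ {u v} → u ~ v → u ≢ v
  ~-irrefl {u} u~v refl = subst T (irrefl G u) u~v

  -- A perfect matching of the subgraph induced by `P`, with `mate` total on `Fin n` but constrained
  -- on `P` only. Passing to a subset closed under `mate`, or to an equivalent predicate, then keeps
  -- the same function.
  record PM (P : Fin n → Set) : Set where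
    field
      mate   : Fin n → Fin n
      mate∈  : ∀ {v} → P v → P (mate v)
      mate²  : ∀ {v} → P v → mate (mate v) ≡ v
      v~mate : ∀ {v} → P v → v ~ mate v

    mate≢ : ∀ {v} → P v → mate v ≢ v
    mate≢ pv eq = ~-irrefl (v~mate pv) (≡-sym eq)

    mate-swap : ∀ {u v} → P u → mate u ≡ v → mate v ≡ u
    mate-swap pu refl = mate² pu

  open PM public

  private
    variable
      P Q R : Fin n → Set
      A B : Subset n

  restrict : (M : PM P) → (∀ {v} → Q v → P v) → (∀ {v} → Q v → Q (mate M v)) → PM Q
  restrict M Q⊆P closed = record
    { mate = mate M ; mate∈ = closed ; mate² = mate² M ∘ Q⊆P ; v~mate = v~mate M ∘ Q⊆P }

  respects : (∀ {v} → P v → Q v) → (∀ {v} → Q v → P v) → PM P → PM Q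
  respects P⊆Q Q⊆P M = restrict M Q⊆P (P⊆Q ∘ mate∈ M ∘ Q⊆P)

  delete-edge : (M : PM P) {v : Fin n} → P v → PM (λ w → P w × w ≢ v × w ≢ mate M v)
  delete-edge M {v} pv = restrict M proj₁ λ (pw , w≢v , w≢mv) →
    mate∈ M pw , (λ mw≡v → w≢mv (≡-sym (mate-swap M pw mw≡v))) ,
    λ mw≡mv → w≢v (trans (≡-sym (mate² M pw)) (trans (cong (mate M) mw≡mv) (mate² M pv)))

  union : (∀ v → Dec (P v)) → PM P → PM Q → (∀ {v} → P v → ¬ Q v) →
          (∀ {v} → R v → P v ⊎ Q v) → (∀ {v} → P v → R v) → (∀ {v} → Q v → R v) → PM R
  union {P} {Q} {R} P? M N disjoint R⊆ P⊆R Q⊆R =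
    record { mate = m ; mate∈ = m∈ ; mate² = m² ; v~mate = v~m }
    where
    m : Fin n → Fin n
    m v with P? v
    ... | yes _ = mate M v
    ... | no _  = mate N v

    mP : ∀ {v} → P v → m v ≡ mate M v
    mP {v} pv with P? v
    ... | yes _ = refl
    ... | no ¬pv = contradiction pv ¬pv

    mQ : ∀ {v} → Q v → m v ≡ mate N v
    mQ {v} qv with P? v
    ... | yes pv = contradiction qv (disjoint pv)
    ... | no _ = refl

    m∈ : ∀ {v} → R v → R (m v)
    m∈ rv with R⊆ rv
    ... | inj₁ pv = subst R (≡-sym (mP pv)) (P⊆R (mate∈ M pv))
    ... | inj₂ qv = subst R (≡-sym (mQ qv)) (Q⊆R (mate∈ N qv))

    m² : ∀ {v} → R v → m (m v) ≡ v
    m² rv with R⊆ rv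
    ... | inj₁ pv = trans (cong m (mP pv)) (trans (mP (mate∈ M pv)) (mate² M pv))
    ... | inj₂ qv = trans (cong m (mQ qv)) (trans (mQ (mate∈ N qv)) (mate² N qv))

    v~m : ∀ {v} → R v → v ~ m v
    v~m {v} rv with R⊆ rv
    ... | inj₁ pv = subst (v ~_) (≡-sym (mP pv)) (v~mate M pv)
    ... | inj₂ qv = subst (v ~_) (≡-sym (mQ qv)) (v~mate N qv)

  single-edge : ∀ {u v} → u ~ v → PM (λ w → w ≡ u ⊎ w ≡ v)
  single-edge {u} {v} u~v = record { mate = m ; mate∈ = m∈ ; mate² = m² ; v~mate = v~m }
    where
    m : Fin n → Fin n
    m w with w ≟ u
    ... | yes _ = v
    ... | no _  = u

    mu : m u ≡ v
    mu with u ≟ u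
    ... | yes _ = refl
    ... | no u≢u = contradiction refl u≢u

    mv : m v ≡ u
    mv with v ≟ u
    ... | yes v≡u = v≡u
    ... | no _ = refl

    m∈ : ∀ {w} → w ≡ u ⊎ w ≡ v → m w ≡ u ⊎ m w ≡ v
    m∈ (inj₁ refl) = inj₂ mu
    m∈ (inj₂ refl) = inj₁ mv

    m² : ∀ {w} → w ≡ u ⊎ w ≡ v → m (m w) ≡ w
    m² (inj₁ refl) = trans (cong m mu) mv
    m² (inj₂ refl) = trans (cong m mv) mu

    v~m : ∀ {w} → w ≡ u ⊎ w ≡ v → w ~ m w
    v~m (inj₁ refl) = subst (u ~_) (≡-sym mu) u~v
    v~m (inj₂ refl) = subst (v ~_) (≡-sym mv) (~-sym u~v)

  add-edge : ∀ {u v} → PM P → u ~ v → ¬ P u → ¬ P v →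
             (∀ {w} → Q w → P w ⊎ (w ≡ u ⊎ w ≡ v)) → (∀ {w} → P w → Q w) → Q u → Q v → PM Q
  add-edge {u = u} {v} M u~v ¬pu ¬pv Q⊆ P⊆Q qu qv =
    union (λ w → (w ≟ u) ⊎-dec (w ≟ v)) (single-edge u~v) M
      (λ { (inj₁ refl) → ¬pu ; (inj₂ refl) → ¬pv })
      ([ inj₂ , inj₁ ]′ ∘ Q⊆) (λ { (inj₁ refl) → qu ; (inj₂ refl) → qv }) P⊆Q

  PM-size-even : PM (_∈ A) → ∣ A ∣ % 2 ≡ 0
  PM-size-even {A} = go ∣ A ∣ A ≤-refl
    where
    go : ∀ k A → ∣ A ∣ ≤ k → PM (_∈ A) → ∣ A ∣ % 2 ≡ 0
    go k A A≤k M with nonempty? A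
    ... | no empty = cong (_% 2) (n≤0⇒n≡0
          (∣∣≤length {xs = []} {p = A} λ x∈ → contradiction (_ , x∈) empty))
    go k A A≤k M | yes (v , v∈) = step k A≤k
      where
      A′ : Subset n
      A′ = A - v - mate M v
      mv∈ : mate M v ∈ A - v
      mv∈ = x∈p∧x≢y⇒x∈p-y (mate∈ M v∈) (mate≢ M v∈)
      size : suc (suc ∣ A′ ∣) ≡ ∣ A ∣
      size = trans (cong suc (suc∣p-x∣≡∣p∣ mv∈)) (suc∣p-x∣≡∣p∣ v∈)
      M′ : PM (_∈ A′)
      M′ = respects (λ (w∈ , w≢v , w≢mv) → x∈p∧x≢y⇒x∈p-y (x∈p∧x≢y⇒x∈p-y w∈ w≢v) w≢mv)
             (λ w∈ → x∈p-y⇒x∈p (x∈p-y⇒x∈p w∈) , x∈p-y⇒x≢y (x∈p-y⇒x∈p w∈) , x∈p-y⇒x≢y w∈) (delete-edge M v∈)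
      step : ∀ k → ∣ A ∣ ≤ k → ∣ A ∣ % 2 ≡ 0
      step zero A≤0 with ≤-trans (≤-reflexive size) A≤0
      ... | ()
      step (suc k) A≤k = trans (cong (_% 2) (≡-sym size))
        (go k A′ (≤-pred (≤-trans (n≤1+n _) (≤-trans (≤-reflexive size) A≤k))) M′)

  abstract
    PM? : ∀ A → Dec (PM (_∈ A))
    PM? A = go ∣ A ∣ A ≤-refl
      where
      go : ∀ k A → ∣ A ∣ ≤ k → Dec (PM (_∈ A))
      go k A A≤k with nonempty? A
      ... | no empty = yes (record { mate = id ; mate∈ = id ; mate² = λ _ → refl ; v~mate = λ v∈ → contradiction (_ , v∈) empty })
      go zero A A≤0 | yes (v , v∈) = contradiction (≤-trans (≤-trans (s≤s z≤n) (x∈p⇒∣p-x∣<∣p∣ v∈)) A≤0) λ ()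
      go (suc k) A A≤k | yes (v , v∈) = map′ to from (any? λ u → ((u ∈? A) ×-dec T? (adj G v u)) ×-dec rec u)
        where
        A-v≤ : ∣ A - v ∣ ≤ k
        A-v≤ = ≤-pred (≤-trans (x∈p⇒∣p-x∣<∣p∣ v∈) A≤k)
        rec : ∀ u → Dec (PM (_∈ A - v - u))
        rec u = go k (A - v - u) (≤-trans (p⊆q⇒∣p∣≤∣q∣ {p = A - v - u} {A - v} x∈p-y⇒x∈p) A-v≤)
        to : Σ (Fin n) (λ u → (u ∈ A × v ~ u) × PM (_∈ A - v - u)) → PM (_∈ A)
        to (u , (u∈ , v~u) , M) = add-edge M v~u
          (λ v∈′ → x∈p-y⇒x≢y (x∈p-y⇒x∈p v∈′) refl) (λ u∈′ → x∈p-y⇒x≢y u∈′ refl) split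
          (λ w∈ → x∈p-y⇒x∈p (x∈p-y⇒x∈p w∈)) v∈ u∈
          where
          split : ∀ {w} → w ∈ A → w ∈ A - v - u ⊎ (w ≡ v ⊎ w ≡ u)
          split {w} w∈ with w ≟ v | w ≟ u
          ... | yes w≡v | _ = inj₂ (inj₁ w≡v)
          ... | no _ | yes w≡u = inj₂ (inj₂ w≡u)
          ... | no w≢v | no w≢u = inj₁ (x∈p∧x≢y⇒x∈p-y (x∈p∧x≢y⇒x∈p-y w∈ w≢v) w≢u)
        from : PM (_∈ A) → Σ (Fin n) (λ u → (u ∈ A × v ~ u) × PM (_∈ A - v - u))
        from M = mate M v , (mate∈ M v∈ , v~mate M v∈) ,
          respects (λ (w∈ , w≢v , w≢mv) → x∈p∧x≢y⇒x∈p-y (x∈p∧x≢y⇒x∈p-y w∈ w≢v) w≢mv)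
               (λ w∈ → x∈p-y⇒x∈p (x∈p-y⇒x∈p w∈) , x∈p-y⇒x≢y (x∈p-y⇒x∈p w∈) , x∈p-y⇒x≢y w∈) (delete-edge M v∈)

  PM-dec : {P : Fin n → Set} → (∀ v → Dec (P v)) → Dec (PM P)
  PM-dec P? = map′ (respects (∈⟪⟫⁻ P?) (∈⟪⟫⁺ P?)) (respects (∈⟪⟫⁺ P?) (∈⟪⟫⁻ P?)) (PM? ⟪ P? ⟫)

  -- The alternating path of the symmetric difference that starts at t ends either at a
  -- vertex h which the second matching covers, or at a vertex which only the first one
  -- covers; the two cases correspond to switching the first, resp. the second, matching.
  abstract
    alternating-path : ∀ {A B t} → PM (_∈ A) → PM (_∈ B) → t ∈ A → t ∉ B →
      (Σ (Fin n) λ h → h ∈ B × h ∉ A × PM (λ w → (w ∈ A × w ≢ t) ⊎ w ≡ h)) ⊎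
      (Σ (Fin n) λ h → h ∈ A × h ∉ B × h ≢ t × PM (λ w → w ∈ B ⊎ (w ≡ t ⊎ w ≡ h)))
    alternating-path {A} {B} {t} = go ∣ A ∣ A B t ≤-refl
      where
      go : ∀ k A B t → ∣ A ∣ ≤ k → PM (_∈ A) → PM (_∈ B) → t ∈ A → t ∉ B →
        (Σ (Fin n) λ h → h ∈ B × h ∉ A × PM (λ w → (w ∈ A × w ≢ t) ⊎ w ≡ h)) ⊎
        (Σ (Fin n) λ h → h ∈ A × h ∉ B × h ≢ t × PM (λ w → w ∈ B ⊎ (w ≡ t ⊎ w ≡ h)))
      go zero A B t A≤0 M N t∈A t∉B = contradiction (≤-trans (≤-trans (s≤s z≤n) (x∈p⇒∣p-x∣<∣p∣ t∈A)) A≤0) λ ()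
      go (suc k) A B t A≤k M N t∈A t∉B with mate M t ∈? B
      ... | no x∉B = inj₂ (mate M t , mate∈ M t∈A , x∉B , mate≢ M t∈A ,
              add-edge N (v~mate M t∈A) t∉B x∉B id inj₁ (inj₂ (inj₁ refl)) (inj₂ (inj₂ refl)))
      ... | yes x∈B with mate N (mate M t) ∈? A
      ...   | no y∉A = inj₁ (mate N (mate M t) , mate∈ N x∈B , y∉A ,
                add-edge {P = λ w → w ∈ A × w ≢ t × w ≢ mate M t} (delete-edge M t∈A) (v~mate N x∈B)
                  (λ (_ , _ , x≢x) → x≢x refl) (y∉A ∘ proj₁) split (λ (w∈ , w≢t , _) → inj₁ (w∈ , w≢t))
                  (inj₁ (mate∈ M t∈A , mate≢ M t∈A)) (inj₂ refl))
        where
        x y : Fin n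
        x = mate M t
        y = mate N x
        split : ∀ {w} → (w ∈ A × w ≢ t) ⊎ w ≡ y → (w ∈ A × w ≢ t × w ≢ x) ⊎ (w ≡ x ⊎ w ≡ y)
        split (inj₂ w≡y) = inj₂ (inj₂ w≡y)
        split {w} (inj₁ (w∈ , w≢t)) with w ≟ x
        ... | yes w≡x = inj₂ (inj₁ w≡x)
        ... | no w≢x = inj₁ (w∈ , w≢t , w≢x)
      -- Without the edges `t x` and `x y` the path goes on from `y`, which is again covered by the
      -- first matching alone. Afterwards `x y` is put back if the first matching was switched,
      -- `t x` if the second was.
      ...   | yes y∈A = switch (go k A′ B′ y A′≤ (restrict′ M A-tx t∈A) (restrict′ N B-xy x∈B) y∈A′ y∉B′)
        where
        x y : Fin n
        x = mate M t
        y = mate N x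
        x∈A : x ∈ A
        x∈A = mate∈ M t∈A
        y∈B : y ∈ B
        y∈B = mate∈ N x∈B
        A-tx : ∀ w → Dec (w ∈ A × w ≢ t × w ≢ x)
        A-tx w = (w ∈? A) ×-dec (¬? (w ≟ t) ×-dec ¬? (w ≟ x))
        B-xy : ∀ w → Dec (w ∈ B × w ≢ x × w ≢ y)
        B-xy w = (w ∈? B) ×-dec (¬? (w ≟ x) ×-dec ¬? (w ≟ y))
        A′ B′ : Subset n
        A′ = ⟪ A-tx ⟫
        B′ = ⟪ B-xy ⟫
        restrict′ : ∀ {C} (K : PM (_∈ C)) {u} (C? : ∀ w → Dec (w ∈ C × w ≢ u × w ≢ mate K u)) → u ∈ C → PM (_∈ ⟪ C? ⟫)
        restrict′ K C? u∈ = respects (∈⟪⟫⁺ C?) (∈⟪⟫⁻ C?) (delete-edge K u∈)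
        A′≤ : ∣ A′ ∣ ≤ k
        A′≤ = ≤-pred (≤-trans (∣p∣<∣q∣ (proj₁ ∘ ∈⟪⟫⁻ A-tx) t∈A λ t∈ → proj₁ (proj₂ (∈⟪⟫⁻ A-tx t∈)) refl) A≤k)
        y≢x : y ≢ x
        y≢x = mate≢ N x∈B
        y≢t : y ≢ t
        y≢t y≡t = t∉B (subst (_∈ B) y≡t y∈B)
        y∈A′ : y ∈ A′
        y∈A′ = ∈⟪⟫⁺ A-tx (y∈A , y≢t , y≢x)
        y∉B′ : y ∉ B′
        y∉B′ y∈ = proj₂ (proj₂ (∈⟪⟫⁻ B-xy y∈)) refl
        switch : (Σ (Fin n) λ h → h ∈ B′ × h ∉ A′ × PM (λ w → (w ∈ A′ × w ≢ y) ⊎ w ≡ h)) ⊎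
                 (Σ (Fin n) λ h → h ∈ A′ × h ∉ B′ × h ≢ y × PM (λ w → w ∈ B′ ⊎ (w ≡ y ⊎ w ≡ h))) →
                 (Σ (Fin n) λ h → h ∈ B × h ∉ A × PM (λ w → (w ∈ A × w ≢ t) ⊎ w ≡ h)) ⊎
                 (Σ (Fin n) λ h → h ∈ A × h ∉ B × h ≢ t × PM (λ w → w ∈ B ⊎ (w ≡ t ⊎ w ≡ h)))
        switch (inj₁ (h , h∈B′ , h∉A′ , K)) with ∈⟪⟫⁻ B-xy h∈B′
        ... | h∈B , h≢x , h≢y = inj₁ (h , h∈B , h∉A ,
                add-edge {u = x} {v = y} K (v~mate N x∈B) ¬x ¬y split back (inj₁ (x∈A , mate≢ M t∈A)) (inj₁ (y∈A , y≢t)))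
          where
          h≢t : h ≢ t
          h≢t h≡t = t∉B (subst (_∈ B) h≡t h∈B)
          h∉A : h ∉ A
          h∉A h∈A = h∉A′ (∈⟪⟫⁺ A-tx (h∈A , h≢t , h≢x))
          ¬x : ¬ ((x ∈ A′ × x ≢ y) ⊎ x ≡ h)
          ¬x (inj₁ (x∈A′ , _)) = proj₂ (proj₂ (∈⟪⟫⁻ A-tx x∈A′)) refl
          ¬x (inj₂ x≡h) = h≢x (≡-sym x≡h)
          ¬y : ¬ ((y ∈ A′ × y ≢ y) ⊎ y ≡ h)
          ¬y (inj₁ (_ , y≢y)) = y≢y refl
          ¬y (inj₂ y≡h) = h≢y (≡-sym y≡h)
          split : ∀ {w} → (w ∈ A × w ≢ t) ⊎ w ≡ h → ((w ∈ A′ × w ≢ y) ⊎ w ≡ h) ⊎ (w ≡ x ⊎ w ≡ y)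
          split (inj₂ w≡h) = inj₁ (inj₂ w≡h)
          split {w} (inj₁ (w∈A , w≢t)) with w ≟ x | w ≟ y
          ... | yes w≡x | _ = inj₂ (inj₁ w≡x)
          ... | no _ | yes w≡y = inj₂ (inj₂ w≡y)
          ... | no w≢x | no w≢y = inj₁ (inj₁ (∈⟪⟫⁺ A-tx (w∈A , w≢t , w≢x) , w≢y))
          back : ∀ {w} → (w ∈ A′ × w ≢ y) ⊎ w ≡ h → (w ∈ A × w ≢ t) ⊎ w ≡ h
          back (inj₂ w≡h) = inj₂ w≡h
          back (inj₁ (w∈A′ , _)) with ∈⟪⟫⁻ A-tx w∈A′
          ... | w∈A , w≢t , _ = inj₁ (w∈A , w≢t)
        switch (inj₂ (h , h∈A′ , h∉B′ , h≢y , K)) with ∈⟪⟫⁻ A-tx h∈A′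
        ... | h∈A , h≢t , h≢x = inj₂ (h , h∈A , h∉B , h≢t ,
                add-edge {u = t} {v = x} K (v~mate M t∈A) ¬t ¬x split back (inj₂ (inj₁ refl)) (inj₁ x∈B))
          where
          h∉B : h ∉ B
          h∉B h∈B = h∉B′ (∈⟪⟫⁺ B-xy (h∈B , h≢x , h≢y))
          ¬t : ¬ (t ∈ B′ ⊎ (t ≡ y ⊎ t ≡ h))
          ¬t (inj₁ t∈B′) = t∉B (proj₁ (∈⟪⟫⁻ B-xy t∈B′))
          ¬t (inj₂ (inj₁ t≡y)) = y≢t (≡-sym t≡y)
          ¬t (inj₂ (inj₂ t≡h)) = h≢t (≡-sym t≡h)
          ¬x : ¬ (x ∈ B′ ⊎ (x ≡ y ⊎ x ≡ h))
          ¬x (inj₁ x∈B′) = proj₁ (proj₂ (∈⟪⟫⁻ B-xy x∈B′)) refl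
          ¬x (inj₂ (inj₁ x≡y)) = y≢x (≡-sym x≡y)
          ¬x (inj₂ (inj₂ x≡h)) = h≢x (≡-sym x≡h)
          split : ∀ {w} → w ∈ B ⊎ (w ≡ t ⊎ w ≡ h) → (w ∈ B′ ⊎ (w ≡ y ⊎ w ≡ h)) ⊎ (w ≡ t ⊎ w ≡ x)
          split (inj₂ (inj₁ w≡t)) = inj₂ (inj₁ w≡t)
          split (inj₂ (inj₂ w≡h)) = inj₁ (inj₂ (inj₂ w≡h))
          split {w} (inj₁ w∈B) with w ≟ x | w ≟ y
          ... | yes w≡x | _ = inj₂ (inj₂ w≡x)
          ... | no _ | yes w≡y = inj₁ (inj₂ (inj₁ w≡y))
          ... | no w≢x | no w≢y = inj₁ (inj₁ (∈⟪⟫⁺ B-xy (w∈B , w≢x , w≢y)))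
          back : ∀ {w} → w ∈ B′ ⊎ (w ≡ y ⊎ w ≡ h) → w ∈ B ⊎ (w ≡ t ⊎ w ≡ h)
          back (inj₁ w∈B′) = inj₁ (proj₁ (∈⟪⟫⁻ B-xy w∈B′))
          back (inj₂ (inj₁ refl)) = inj₁ y∈B
          back (inj₂ (inj₂ w≡h)) = inj₂ (inj₂ w≡h)

-- Perfect matchings as edge lists and as involutions

∈-irrelevant : ∀ {n} {p : Subset n} {x} (a b : x ∈ p) → a ≡ b
∈-irrelevant here here = refl
∈-irrelevant (there a) (there b) = cong there (∈-irrelevant a b)

record Finite (A : Set) : Set where
  field
    list     : List A
    complete : ∀ a → a LM.∈ list
    decEq    : DecidableEquality A

finite-Fin : ∀ n → Finite (Fin n)
finite-Fin n = record { list = allFin n ; complete = LMP.∈-allFin ; decEq = _≟_ }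

finite-⊤ : Finite ⊤
finite-⊤ = record { list = tt ∷ [] ; complete = λ _ → here refl ; decEq = λ _ _ → yes refl }

finite-⊎ : ∀ {A B} → Finite A → Finite B → Finite (A ⊎ B)
finite-⊎ {A} {B} FA FB = record
  { list = map inj₁ (list FA) ++ map inj₂ (list FB)
  ; complete = complete′
  ; decEq = SumP.≡-dec (decEq FA) (decEq FB) }
  where
  open Finite
  complete′ : ∀ x → x LM.∈ map inj₁ (list FA) ++ map inj₂ (list FB)
  complete′ (inj₁ a) = LMP.∈-++⁺ˡ (LMP.∈-map⁺ inj₁ (complete FA a))
  complete′ (inj₂ b) = LMP.∈-++⁺ʳ (map inj₁ (list FA)) (LMP.∈-map⁺ inj₂ (complete FB b))

module _ {A : Set} {P : A → Set} (FA : Finite A) (P? : ∀ a → Dec (P a)) (irr : ∀ {a} (p q : P a) → p ≡ q) where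
  open Finite

  finite-Σ : Finite (Σ A P)
  finite-Σ = record { list = pairs (list FA) ; complete = λ (a , p) → complete′ p (complete FA a) ; decEq = eq? }
    where
    cons : ∀ {a} → Dec (P a) → List (Σ A P) → List (Σ A P)
    cons {a} (yes p) xs = (a , p) ∷ xs
    cons (no _) xs = xs
    pairs : List A → List (Σ A P)
    pairs [] = []
    pairs (a ∷ as) = cons (P? a) (pairs as)
    cons-here : ∀ {a} (p : P a) (d : Dec (P a)) {xs} → (a , p) LM.∈ cons d xs
    cons-here p (yes q) = here (cong (_ ,_) (irr p q))
    cons-here p (no ¬p) = contradiction p ¬p
    cons-there : ∀ {a x xs} (d : Dec (P a)) → x LM.∈ xs → x LM.∈ cons d xs
    cons-there (yes _) x∈ = there x∈
    cons-there (no _) x∈ = x∈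
    complete′ : ∀ {a as} (p : P a) → a LM.∈ as → (a , p) LM.∈ pairs as
    complete′ p (here refl) = cons-here p (P? _)
    complete′ {as = b ∷ _} p (there a∈) = cons-there (P? b) (complete′ p a∈)
    eq? : DecidableEquality (Σ A P)
    eq? (a , p) (b , q) with decEq FA a b
    ... | yes refl = yes (cong (a ,_) (irr p q))
    ... | no a≢b = no (a≢b ∘ cong proj₁)

record Pairing (𝒢 : Gr) : Set where
  field
    partner   : V 𝒢 → V 𝒢
    partner²  : ∀ v → partner (partner v) ≡ v
    v~partner : ∀ v → E 𝒢 v (partner v)
open Pairing public

module _ {𝒢 : Gr} where

  private
    Vx : Set
    Vx = V 𝒢

  Joined : List (Vx × Vx) → Vx → Vx → Set
  Joined M u v = (u , v) LM.∈ M ⊎ (v , u) LM.∈ M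

  private
    joined-swap : ∀ {M u v} → Joined M u v → Joined M v u
    joined-swap (inj₁ e) = inj₂ e
    joined-swap (inj₂ e) = inj₁ e

    weaken : ∀ {e M u v} → Joined M u v → Joined (e ∷ M) u v
    weaken (inj₁ e) = inj₁ (there e)
    weaken (inj₂ e) = inj₂ (there e)

    uncons : ∀ {a b M u v} → Joined ((a , b) ∷ M) u v → (u ≡ a × v ≡ b) ⊎ (u ≡ b × v ≡ a) ⊎ Joined M u v
    uncons (inj₁ (here refl)) = inj₁ (refl , refl)
    uncons (inj₁ (there e)) = inj₂ (inj₂ (inj₁ e))
    uncons (inj₂ (here refl)) = inj₂ (inj₁ (refl , refl))
    uncons (inj₂ (there e)) = inj₂ (inj₂ (inj₂ e))

    joined-∃ : ∀ M {v} → v LM.∈ ends M → Σ Vx (Joined M v)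
    joined-∃ ((a , b) ∷ M) (here refl) = b , inj₁ (here refl)
    joined-∃ ((a , b) ∷ M) (there (here refl)) = a , inj₂ (here refl)
    joined-∃ ((a , b) ∷ M) (there (there v∈)) with joined-∃ M v∈
    ... | u , j = u , weaken j

    joined-∈ : ∀ M {u v} → Joined M u v → u LM.∈ ends M
    joined-∈ [] (inj₁ ())
    joined-∈ [] (inj₂ ())
    joined-∈ (_ ∷ M) j with uncons j
    ... | inj₁ (refl , _) = here refl
    ... | inj₂ (inj₁ (refl , _)) = there (here refl)
    ... | inj₂ (inj₂ j′) = there (there (joined-∈ M j′))

    joined-unique : ∀ M → Unique (ends M) → ∀ {u v w} → Joined M u v → Joined M u w → v ≡ w
    joined-unique [] _ (inj₁ ())
    joined-unique [] _ (inj₂ ())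
    joined-unique (_ ∷ M) (a∉ ∷ b∉ ∷ un) j k with uncons j | uncons k
    ... | inj₁ (refl , refl) | inj₁ (_ , refl) = refl
    ... | inj₁ (refl , refl) | inj₂ (inj₁ (refl , refl)) = refl
    ... | inj₁ (refl , refl) | inj₂ (inj₂ k′) = contradiction refl (All.lookup a∉ (there (joined-∈ M k′)))
    ... | inj₂ (inj₁ (refl , refl)) | inj₁ (refl , refl) = refl
    ... | inj₂ (inj₁ (refl , refl)) | inj₂ (inj₁ (_ , refl)) = refl
    ... | inj₂ (inj₁ (refl , refl)) | inj₂ (inj₂ k′) = contradiction refl (All.lookup b∉ (joined-∈ M k′))
    ... | inj₂ (inj₂ j′) | inj₁ (refl , _) = contradiction refl (All.lookup a∉ (there (joined-∈ M j′)))
    ... | inj₂ (inj₂ j′) | inj₂ (inj₁ (refl , _)) = contradiction refl (All.lookup b∉ (joined-∈ M j′))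
    ... | inj₂ (inj₂ j′) | inj₂ (inj₂ k′) = joined-unique M un j′ k′

  module _ (E-sym : ∀ {u v} → E 𝒢 u v → E 𝒢 v u) where

    abstract
      -- The second component remembers the listed edges, because `Allowed` asks for a matching
      -- through a prescribed edge.
      toPairing : (M : PerfectMatching 𝒢) → Σ (Pairing 𝒢) λ F → ∀ {u v} → Joined (proj₁ M) u v → partner F u ≡ v
      toPairing (M , (edges , un) , covers) =
        record { partner = f ; partner² = λ v → f-joined (joined-swap (j v)) ; v~partner = edge } , f-joined
        where
        f : Vx → Vx
        f v = proj₁ (joined-∃ M (covers v))
        j : ∀ v → Joined M v (f v)
        j v = proj₂ (joined-∃ M (covers v))
        f-joined : ∀ {u v} → Joined M u v → f u ≡ v
        f-joined = joined-unique M un (j _)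
        edge : ∀ v → E 𝒢 v (f v)
        edge v with j v
        ... | inj₁ e = All.lookup edges e
        ... | inj₂ e = E-sym (All.lookup edges e)

  module _ (FV : Finite Vx) (E-irrefl : ∀ {v} → ¬ E 𝒢 v v) where
    open Finite FV
    open import Data.List.Membership.DecPropositional decEq using () renaming (_∈?_ to _∈L?_)

    abstract
      -- Edges `v , f v` are added greedily along a list of all vertices. If `v` is still uncovered,
      -- so is `f v`: all edges present are pairs of `f`, so the one covering `f v` would also cover
      -- `v`.
      fromPairing : (F : Pairing 𝒢) → Σ (PerfectMatching 𝒢) λ M → ∀ u → Joined (proj₁ M) u (partner F u)
      fromPairing F with go list
        where
        f : Vx → Vx
        f = partner F
        go : ∀ L → Σ (List (Vx × Vx)) λ M → IsMatching 𝒢 M × (∀ {v} → v LM.∈ L → v LM.∈ ends M) ×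
                                            (∀ {u v} → Joined M u v → f u ≡ v)
        go [] = [] , ([] , []) , (λ ()) , λ { (inj₁ ()) ; (inj₂ ()) }
        go (v ∷ L) with go L
        ... | M , (edges , un) , covers , f-joined with v ∈L? ends M
        ...   | yes v∈ = M , (edges , un) , (λ { (here refl) → v∈ ; (there w∈) → covers w∈ }) , f-joined
        ...   | no v∉ = (v , f v) ∷ M , (v~partner F v ∷ edges , (v≢fv ∷ v∉′) ∷ (fv∉′ ∷ un)) ,
                  (λ { (here refl) → here refl ; (there w∈) → there (there (covers w∈)) }) , joined
          where
          v≢fv : v ≢ f v
          v≢fv eq = E-irrefl (subst (E 𝒢 v) (≡-sym eq) (v~partner F v))
          v∉′ : All (v ≢_) (ends M)
          v∉′ = AllP.¬Any⇒All¬ (ends M) v∉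
          fv∉ : ¬ (f v LM.∈ ends M)
          fv∉ fv∈ with joined-∃ M fv∈
          ... | u , j = v∉ (subst (LM._∈ ends M) (trans (≡-sym (f-joined j)) (partner² F v)) (joined-∈ M (joined-swap j)))
          fv∉′ : All (f v ≢_) (ends M)
          fv∉′ = AllP.¬Any⇒All¬ (ends M) fv∉
          joined : ∀ {u w} → Joined ((v , f v) ∷ M) u w → f u ≡ w
          joined j with uncons j
          ... | inj₁ (refl , refl) = refl
          ... | inj₂ (inj₁ (refl , refl)) = partner² F v
          ... | inj₂ (inj₂ j′) = f-joined j′
      ... | M , isM , covers , f-joined = (M , isM , λ v → covers (complete v)) , j
        where
        j : ∀ u → Joined M u (partner F u)
        j u with joined-∃ M (covers (complete u))
        ... | v , j′ rewrite f-joined j′ = j′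

-- Allowed edges and factor-components

module Factors {n : ℕ} (G : Graph n) where
  open Matchings G public

  Whole : Fin n → Set
  Whole _ = ⊤

  pairing⇒PM : Pairing ⟦ G ⟧ → PM Whole
  pairing⇒PM F = record { mate = partner F ; mate∈ = λ _ → tt ; mate² = λ {v} _ → partner² F v ; v~mate = λ {v} _ → v~partner F v }

  PM⇒pairing : PM Whole → Pairing ⟦ G ⟧
  PM⇒pairing M = record { partner = mate M ; partner² = λ _ → mate² M tt ; v~partner = λ _ → v~mate M tt }

  factorizable⇒PM : Factorizable ⟦ G ⟧ → PM Whole
  factorizable⇒PM M = pairing⇒PM (proj₁ (toPairing ~-sym M))

  abstract
    allowed⇒PM : ∀ {u v} → Allowed ⟦ G ⟧ u v → Σ (PM Whole) λ M → mate M u ≡ v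
    allowed⇒PM (M , j) with toPairing ~-sym M
    ... | F , eq = pairing⇒PM F , eq j

  abstract
    PM⇒allowed : (M : PM Whole) → ∀ u → Allowed ⟦ G ⟧ u (mate M u)
    PM⇒allowed M u with fromPairing (finite-Fin n) (λ e → ~-irrefl e refl) (PM⇒pairing M)
    ... | K , j = K , j u

  allowed-sym : ∀ {u v} → Allowed ⟦ G ⟧ u v → Allowed ⟦ G ⟧ v u
  allowed-sym (M , inj₁ e) = M , inj₂ e
  allowed-sym (M , inj₂ e) = M , inj₁ e

  allowed⇒~ : ∀ {u v} → Allowed ⟦ G ⟧ u v → u ~ v
  allowed⇒~ {u} a with allowed⇒PM a
  ... | M , eq = subst (u ~_) eq (v~mate M tt)

  module _ {u v : Fin n} (u~v : u ~ v) (M : PM (λ w → w ≢ u × w ≢ v)) where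

    complete-by-edge : PM Whole
    complete-by-edge = union (λ w → (w ≟ u) ⊎-dec (w ≟ v)) (single-edge u~v) M
        (λ { (inj₁ refl) (≢u , _) → ≢u refl ; (inj₂ refl) (_ , ≢v) → ≢v refl })
        (λ {w} _ → split w) (λ _ → tt) (λ _ → tt)
      where
      split : ∀ w → (w ≡ u ⊎ w ≡ v) ⊎ (w ≢ u × w ≢ v)
      split w with w ≟ u | w ≟ v
      ... | yes e | _ = inj₁ (inj₁ e)
      ... | no _ | yes e = inj₁ (inj₂ e)
      ... | no a | no b = inj₂ (a , b)

    complete-by-edge-mate : mate complete-by-edge u ≡ v
    complete-by-edge-mate with (u ≟ u) | (u ≟ v)
    ... | no u≢u | _ = contradiction refl u≢u
    ... | yes _ | yes u≡v = contradiction u≡v (~-irrefl u~v)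
    ... | yes _ | no _ with u ≟ u
    ...   | yes _ = refl
    ...   | no u≢u = contradiction refl u≢u

    edge-allowed : Allowed ⟦ G ⟧ u v
    edge-allowed = subst (Allowed ⟦ G ⟧ u) complete-by-edge-mate (PM⇒allowed complete-by-edge u)

  -- The quantification over edge lists reduces to one decidable question: whether the graph without
  -- the two ends of the edge has a perfect matching. Membership in a factor-component becomes
  -- decidable through it.
  allowed? : ∀ u v → Dec (Allowed ⟦ G ⟧ u v)
  allowed? u v = map′ (λ (e , M) → edge-allowed e M) (λ a → allowed⇒~ a , rest a)
    (T? (adj G u v) ×-dec PM-dec (λ w → ¬? (w ≟ u) ×-dec ¬? (w ≟ v)))
    where
    rest : Allowed ⟦ G ⟧ u v → PM (λ w → w ≢ u × w ≢ v)
    rest a with allowed⇒PM a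
    ... | M , refl = respects proj₂ (tt ,_) (delete-edge M tt)

  abstract
    FCG? : ∀ u v → Dec (FCG G u v)
    FCG? = star? allowed?

  FCG-sym : ∀ {u v} → FCG G u v → FCG G v u
  FCG-sym ε = ε
  FCG-sym (a ◅ as) = FCG-sym as ◅◅ (allowed-sym a ◅ ε)

  FCG-mate : (M : PM Whole) → ∀ {u v} → FCG G u v → FCG G u (mate M v)
  FCG-mate M p = p ◅◅ (PM⇒allowed M _ ◅ ε)

  module _ {P : Fin n → Set} (P? : ∀ v → Dec (P v)) (irr : ∀ {v} (p q : P v) → p ≡ q) where

    PM⇒factorizable : PM P → Factorizable (Induce ⟦ G ⟧ P)
    PM⇒factorizable M = proj₁ (fromPairing (finite-Σ (finite-Fin n) P? irr) (λ e → ~-irrefl e refl) F)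
      where
      Σ-≡ : ∀ {a b : Σ (Fin n) P} → proj₁ a ≡ proj₁ b → a ≡ b
      Σ-≡ {a , p} {_ , q} refl = cong (a ,_) (irr p q)
      F : Pairing (Induce ⟦ G ⟧ P)
      F = record { partner = λ (v , p) → mate M v , mate∈ M p ; partner² = λ (v , p) → Σ-≡ (mate² M p) ; v~partner = λ (v , p) → v~mate M p }

    factorizable⇒PM-induced : Factorizable (Induce ⟦ G ⟧ P) → PM P
    factorizable⇒PM-induced K with toPairing {𝒢 = Induce ⟦ G ⟧ P} ~-sym K
    ... | F , _ = record { mate = m ; mate∈ = λ p → subst P (≡-sym (m-eq p)) (proj₂ (partner F (_ , p)))
                         ; mate² = m² ; v~mate = λ {v} p → subst (v ~_) (≡-sym (m-eq p)) (v~partner F (v , p)) }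
      where
      m : Fin n → Fin n
      m v with P? v
      ... | yes p = proj₁ (partner F (v , p))
      ... | no _ = v
      m-eq : ∀ {v} (p : P v) → m v ≡ proj₁ (partner F (v , p))
      m-eq {v} p with P? v
      ... | yes q = cong (λ r → proj₁ (partner F (v , r))) (irr q p)
      ... | no ¬p = contradiction p ¬p
      m² : ∀ {v} → P v → m (m v) ≡ v
      m² {v} p = trans (cong m (m-eq p)) (trans (m-eq _) (cong proj₁ (partner² F (v , p))))

-- Gallai's lemma and the Tutte–Berge formula

even-suc : ∀ m → m % 2 ≡ 0 → suc m % 2 ≡ 1
even-suc zero _ = refl
even-suc (suc (suc m)) e = even-suc m e

even-not-suc : ∀ m → m % 2 ≡ 0 → ¬ suc m % 2 ≡ 0
even-not-suc m e e′ with trans (≡-sym (even-suc m e)) e′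
... | ()

even⊎odd : ∀ m → m % 2 ≡ 0 ⊎ m % 2 ≡ 1
even⊎odd zero = inj₁ refl
even⊎odd (suc zero) = inj₂ refl
even⊎odd (suc (suc m)) = even⊎odd m

even-gap : ∀ {a b} → a % 2 ≡ 0 → b % 2 ≡ 0 → a < b → suc (suc a) ≤ b
even-gap {a} ea eb a<b with m≤n⇒m<n∨m≡n a<b
... | inj₁ lt = lt
... | inj₂ refl = contradiction eb (even-not-suc a ea)

unique-map : {A B : Set} (f : A → B) {xs : List A} → Unique xs →
             (∀ {x y} → x LM.∈ xs → y LM.∈ xs → f x ≡ f y → x ≡ y) → Unique (map f xs)
unique-map f [] _ = []
unique-map f (x∉ ∷ un) inj =
  AllP.map⁺ (All.tabulate (λ y∈ eq → All.lookup x∉ y∈ (inj (here refl) (there y∈) eq))) ∷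
  unique-map f un (λ x∈ y∈ → inj (there x∈) (there y∈))

module TutteBerge {n : ℕ} (G : Graph n) where
  open Factors G public

  -- `Component (_∉ X)` unfolds to `IsComp G X`; a general predicate lets the Tutte-Berge argument
  -- run inside a single `K j - v`.
  Component : (Fin n → Set) → Subset n → Set
  Component P C = (∀ v → v ∈ C → P v)
                × Nonempty C
                × (∀ u v → u ∈ C → v ∈ C → Star (λ a b → a ∈ C × b ∈ C × T (adj G a b)) u v)
                × (∀ u v → u ∈ C → P v → T (adj G u v) → v ∈ C)

  OddComponent : (Fin n → Set) → Subset n → Set
  OddComponent P C = Component P C × ∣ C ∣ % 2 ≡ 1

  respects-component : {P Q : Fin n → Set} → (∀ {v} → P v → Q v) → (∀ {v} → Q v → P v) → ∀ {C} → OddComponent P C → OddComponent Q C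
  respects-component P⊆Q Q⊆P ((C⊆P , ne , conn , closed) , odd) =
    ((λ v v∈ → P⊆Q (C⊆P v v∈)) , ne , conn , λ u v u∈ qv → closed u v u∈ (Q⊆P qv)) , odd

  module _ {P : Fin n → Set} (P? : ∀ v → Dec (P v)) where

    Step : Fin n → Fin n → Set
    Step a b = P a × P b × a ~ b

    step? : ∀ a b → Dec (Step a b)
    step? a b = P? a ×-dec (P? b ×-dec T? (adj G a b))

    step-sym : ∀ {u v} → Star Step u v → Star Step v u
    step-sym ε = ε
    step-sym ((pa , pb , e) ◅ s) = step-sym s ◅◅ ((pb , pa , ~-sym e) ◅ ε)

    step-end : ∀ {u v} → P u → Star Step u v → P v
    step-end pu ε = pu
    step-end pu ((_ , pb , _) ◅ s) = step-end pb s

    component : Fin n → Subset n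
    component v = ⟪ star? step? v ⟫

    ∈-component⁺ : ∀ {v w} → Star Step v w → w ∈ component v
    ∈-component⁺ = ∈⟪⟫⁺ (star? step? _)

    ∈-component⁻ : ∀ {v w} → w ∈ component v → Star Step v w
    ∈-component⁻ = ∈⟪⟫⁻ (star? step? _)

    component-isComponent : ∀ {v} → P v → Component P (component v)
    component-isComponent {v} pv =
      (λ w w∈ → step-end pv (∈-component⁻ w∈)) , (v , ∈-component⁺ ε) ,
      (λ u w u∈ w∈ → inside-C (∈-component⁻ u∈) (step-sym (∈-component⁻ u∈) ◅◅ ∈-component⁻ w∈)) ,
      λ u w u∈ pw u~w → ∈-component⁺ (∈-component⁻ u∈ ◅◅ ((step-end pv (∈-component⁻ u∈) , pw , u~w) ◅ ε))
      where
      C : Subset n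
      C = component v
      inside-C : ∀ {u w} → Star Step v u → Star Step u w → Star (λ a b → a ∈ C × b ∈ C × T (adj G a b)) u w
      inside-C vu ε = ε
      inside-C vu (r@(_ , _ , a~b) ◅ s) = (∈-component⁺ vu , ∈-component⁺ vb , a~b) ◅ inside-C vb s
        where
        vb : Star Step v _
        vb = vu ◅◅ (r ◅ ε)

  module Gallai (P A : Subset n)
    (A-max : ∀ B → (∀ {v} → v ∈ B → v ∈ P) → PM (_∈ B) → ∣ B ∣ ≤ ∣ A ∣)
    (avoidable : ∀ v → v ∈ P → Σ (Subset n) λ B → (∀ {v} → v ∈ B → v ∈ P) × PM (_∈ B) × v ∉ B × ∣ A ∣ ≤ ∣ B ∣) where

    no-augmentation : ∀ {B u v} → (∀ {w} → w ∈ B → w ∈ P) → ∣ A ∣ ≤ ∣ B ∣ →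
                      PM (λ w → w ∈ B ⊎ (w ≡ u ⊎ w ≡ v)) → u ∈ P → v ∈ P → u ∉ B → ⊥
    no-augmentation {B} {u} {v} B⊆P A≤B M u∈ v∈ u∉ =
      <⇒≱ (∣p∣<∣q∣ (∈⟪⟫⁺ B+? ∘ inj₁) (∈⟪⟫⁺ B+? (inj₂ (inj₁ refl))) u∉)
          (≤-trans (A-max ⟪ B+? ⟫ (λ w∈ → B+⊆P (∈⟪⟫⁻ B+? w∈)) (respects (∈⟪⟫⁺ B+?) (∈⟪⟫⁻ B+?) M)) A≤B)
      where
      B+? : ∀ w → Dec (w ∈ B ⊎ (w ≡ u ⊎ w ≡ v))
      B+? w = (w ∈? B) ⊎-dec ((w ≟ u) ⊎-dec (w ≟ v))
      B+⊆P : ∀ {w} → w ∈ B ⊎ (w ≡ u ⊎ w ≡ v) → w ∈ P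
      B+⊆P (inj₁ w∈) = B⊆P w∈
      B+⊆P (inj₂ (inj₁ refl)) = u∈
      B+⊆P (inj₂ (inj₂ refl)) = v∈

    no-missed-edge : ∀ {B u v} → (∀ {w} → w ∈ B → w ∈ P) → ∣ A ∣ ≤ ∣ B ∣ → PM (_∈ B) →
                     u ∈ P → v ∈ P → u ∉ B → v ∉ B → ¬ u ~ v
    no-missed-edge B⊆P A≤B M u∈ v∈ u∉ v∉ u~v =
      no-augmentation B⊆P A≤B (add-edge M u~v u∉ v∉ id inj₁ (inj₂ (inj₁ refl)) (inj₂ (inj₂ refl))) u∈ v∈ u∉

    -- Induction along the walk while the matching changes. If the next vertex `t` is covered, the
    -- path from `t` against a maximum matching missing `t` either augments the latter or yields a
    -- matching of the same size that uncovers `t` and covers a single new vertex `h`. If `h` is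
    -- `v`, then the adjacent `u` and `t` are both missed; otherwise `t` and `v` are missed and the
    -- walk is shorter.
    gallai : ∀ {u v} → Star (Step (_∈? P)) u v → u ≢ v → ∀ B → (∀ {w} → w ∈ B → w ∈ P) → PM (_∈ B) →
             ∣ A ∣ ≤ ∣ B ∣ → v ∈ P → u ∉ B → v ∉ B → ⊥
    gallai ε u≢u _ _ _ _ _ _ _ = u≢u refl
    gallai {u} {v} (_◅_ {j = t} (u∈ , t∈ , u~t) s) u≢v B B⊆P M A≤B v∈ u∉ v∉ with t ≟ v
    ... | yes refl = no-missed-edge B⊆P A≤B M u∈ v∈ u∉ v∉ u~t
    ... | no t≢v with t ∈? B
    ...   | no t∉ = no-missed-edge B⊆P A≤B M u∈ t∈ u∉ t∉ u~t
    ...   | yes t∈B with avoidable t t∈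
    ...     | B′ , B′⊆P , M′ , t∉B′ , A≤B′ with alternating-path M M′ t∈B t∉B′
    ...       | inj₂ (h , h∈B , _ , _ , K) = no-augmentation B′⊆P A≤B′ K t∈ (B⊆P h∈B) t∉B′
    ...       | inj₁ (h , h∈B′ , h∉B , K) = conclude (h ≟ v)
      where
      B₁? : ∀ w → Dec ((w ∈ B × w ≢ t) ⊎ w ≡ h)
      B₁? w = ((w ∈? B) ×-dec ¬? (w ≟ t)) ⊎-dec (w ≟ h)
      B₁ : Subset n
      B₁ = ⟪ B₁? ⟫
      B₁⊆P : ∀ {w} → w ∈ B₁ → w ∈ P
      B₁⊆P w∈ with ∈⟪⟫⁻ B₁? w∈
      ... | inj₁ (w∈B , _) = B⊆P w∈B
      ... | inj₂ refl = B′⊆P h∈B′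
      M₁ : PM (_∈ B₁)
      M₁ = respects (∈⟪⟫⁺ B₁?) (∈⟪⟫⁻ B₁?) K
      A≤B₁ : ∣ A ∣ ≤ ∣ B₁ ∣
      A≤B₁ = ≤-trans A≤B (≤-trans (≤-reflexive (≡-sym (suc∣p-x∣≡∣p∣ t∈B)))
               (∣p∣<∣q∣ {p = B - t} {x = h} (λ w∈ → ∈⟪⟫⁺ B₁? (inj₁ (x∈p-y⇒x∈p w∈ , x∈p-y⇒x≢y w∈)))
                        (∈⟪⟫⁺ B₁? (inj₂ refl)) (λ h∈ → h∉B (x∈p-y⇒x∈p h∈))))
      missed : ∀ {w} → w ∉ B → w ≢ h → w ∉ B₁
      missed w∉ w≢h w∈ with ∈⟪⟫⁻ B₁? w∈
      ... | inj₁ (w∈B , _) = w∉ w∈B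
      ... | inj₂ w≡h = w≢h w≡h
      t∉B₁ : t ∉ B₁
      t∉B₁ t∈B₁ with ∈⟪⟫⁻ B₁? t∈B₁
      ... | inj₁ (_ , t≢t) = t≢t refl
      ... | inj₂ refl = h∉B t∈B
      conclude : Dec (h ≡ v) → ⊥
      conclude (yes refl) = no-missed-edge B₁⊆P A≤B₁ M₁ u∈ t∈ (missed u∉ u≢v) t∉B₁ u~t
      conclude (no h≢v) = gallai s t≢v B₁ B₁⊆P M₁ A≤B₁ v∈ t∉B₁ (missed v∉ (h≢v ∘ ≡-sym))

  -- The hard half of the Tutte-Berge formula. `A` is the set covered by a matching, `Y` the
  -- witness, and `bound` says, free of subtraction, that the deficiency `|P| - |A|` is at most the
  -- number of listed odd components minus `|Y|`.
  record Formula (P : Subset n) : Set where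
    field
      A Y : Subset n
      Cs : List (Subset n)
      A⊆P : ∀ {v} → v ∈ A → v ∈ P
      matching : PM (_∈ A)
      Y⊆P : ∀ {v} → v ∈ Y → v ∈ P
      Cs-unique : Unique Cs
      Cs-odd : ∀ {C} → C LM.∈ Cs → OddComponent (λ v → v ∈ P × v ∉ Y) C
      bound : ∣ P ∣ + ∣ Y ∣ ≤ ∣ A ∣ + length Cs

  Submatching : Subset n → Subset n → Set
  Submatching P B = (∀ v → v ∈ B → v ∈ P) × PM (_∈ B)

  submatching? : ∀ P B → Dec (Submatching P B)
  submatching? P B = all? (λ v → (v ∈? B) →-dec (v ∈? P)) ×-dec PM? B

  -- Either some vertex is covered by every maximum matching and is moved to Y, or Gallai's
  -- lemma shows that every component contains at most one vertex missed by A.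
  abstract
    tutte-berge : ∀ P → Formula P
    tutte-berge P = go ∣ P ∣ P ≤-refl
      where
      go : ∀ k P → ∣ P ∣ ≤ k → Formula P
      go k P P≤k with maximum-subset (submatching? P) (∅ , (λ v v∈ → contradiction v∈ ∉⊥) ,
             record { mate = id ; mate∈ = id ; mate² = λ _ → refl ; v~mate = λ v∈ → contradiction v∈ ∉⊥ })
      ... | A , (A⊆P , M) , A-max with any? (λ v → (v ∈? P) ×-dec ¬? (anySubset? λ B → submatching? (P - v) B ×-dec (∣ A ∣ ≤? ∣ B ∣)))
      ...   | no ¬critical = record
                { A = A ; Y = ∅ ; Cs = map (component (_∈? P)) missed ; A⊆P = A⊆P _ ; matching = M ; Y⊆P = λ v∈ → contradiction v∈ ∉⊥
                ; Cs-unique = unique-map _ (elems-unique ⟪ P\A? ⟫) same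
                ; Cs-odd = Cs-odd
                ; bound = bound }
        where
        A-max′ : ∀ B → (∀ {v} → v ∈ B → v ∈ P) → PM (_∈ B) → ∣ B ∣ ≤ ∣ A ∣
        A-max′ B B⊆P K = A-max B ((λ _ → B⊆P) , K)
        avoidable : ∀ v → v ∈ P → Σ (Subset n) λ B → (∀ {v} → v ∈ B → v ∈ P) × PM (_∈ B) × v ∉ B × ∣ A ∣ ≤ ∣ B ∣
        avoidable v v∈ with anySubset? (λ B → submatching? (P - v) B ×-dec (∣ A ∣ ≤? ∣ B ∣))
        ... | yes (B , (B⊆ , K) , A≤B) = B , (λ w∈ → x∈p-y⇒x∈p (B⊆ _ w∈)) , K , (λ v∈B → x∈p-y⇒x≢y (B⊆ _ v∈B) refl) , A≤B
        ... | no ¬∃ = contradiction (v , v∈ , ¬∃) ¬critical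
        open Gallai P A A-max′ avoidable
        P\A? : ∀ v → Dec (v ∈ P × v ∉ A)
        P\A? v = (v ∈? P) ×-dec ¬? (v ∈? A)
        missed : List (Fin n)
        missed = elems ⟪ P\A? ⟫
        missed⁻ : ∀ {v} → v LM.∈ missed → v ∈ P × v ∉ A
        missed⁻ v∈ = ∈⟪⟫⁻ P\A? (∈-elems⁻ v∈)
        joined : ∀ {u v} → u ∈ P → u ∉ A → Star (Step (_∈? P)) u v → v ∉ A → u ≡ v
        joined {u} {v} u∈ u∉ s v∉ with u ≟ v
        ... | yes u≡v = u≡v
        ... | no u≢v = ⊥-elim (gallai s u≢v A (A⊆P _) M ≤-refl (step-end (_∈? P) u∈ s) u∉ v∉)
        same : ∀ {u v} → u LM.∈ missed → v LM.∈ missed → component (_∈? P) u ≡ component (_∈? P) v → u ≡ v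
        same {u} {v} u∈ v∈ eq = joined (proj₁ (missed⁻ u∈)) (proj₂ (missed⁻ u∈))
          (∈-component⁻ (_∈? P) (subst (v ∈_) (≡-sym eq) (∈-component⁺ (_∈? P) ε))) (proj₂ (missed⁻ v∈))
        -- By Gallai's lemma `u` is the only missed vertex of its component, so `M` matches the
        -- remaining vertices among themselves and their number is even.
        Cs-odd : ∀ {C} → C LM.∈ map (component (_∈? P)) missed → OddComponent (λ v → v ∈ P × v ∉ ∅) C
        Cs-odd C∈ with LMP.∈-map⁻ (component (_∈? P)) C∈
        ... | u , u∈L , refl = respects-component {P = _∈ P} (_, ∉⊥) proj₁
                (component-isComponent (_∈? P) u∈P ,
                 subst (λ m → m % 2 ≡ 1) (suc∣p-x∣≡∣p∣ u∈C) (even-suc ∣ C - u ∣ (PM-size-even (restrict M C-u⊆A closed))))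
          where
          C : Subset n
          C = component (_∈? P) u
          u∈P : u ∈ P
          u∈P = proj₁ (missed⁻ u∈L)
          u∉A : u ∉ A
          u∉A = proj₂ (missed⁻ u∈L)
          u∈C : u ∈ C
          u∈C = ∈-component⁺ (_∈? P) ε
          C-u⊆A : ∀ {w} → w ∈ C - u → w ∈ A
          C-u⊆A {w} w∈ with w ∈? A
          ... | yes w∈A = w∈A
          ... | no w∉A = contradiction (≡-sym (joined u∈P u∉A (∈-component⁻ (_∈? P) (x∈p-y⇒x∈p w∈)) w∉A)) (x∈p-y⇒x≢y w∈)
          closed : ∀ {w} → w ∈ C - u → mate M w ∈ C - u
          closed w∈ = x∈p∧x≢y⇒x∈p-y
            (∈-component⁺ (_∈? P) (∈-component⁻ (_∈? P) (x∈p-y⇒x∈p w∈) ◅◅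
               ((A⊆P _ (C-u⊆A w∈) , A⊆P _ (mate∈ M (C-u⊆A w∈)) , v~mate M (C-u⊆A w∈)) ◅ ε)))
            (λ eq → u∉A (subst (_∈ A) eq (mate∈ M (C-u⊆A w∈))))
        bound : ∣ P ∣ + ∣ ∅ {n} ∣ ≤ ∣ A ∣ + length (map (component (_∈? P)) missed)
        bound = begin
          ∣ P ∣ + ∣ ∅ {n} ∣                 ≡⟨ trans (cong (∣ P ∣ +_) (∣⊥∣≡0 n)) (+-identityʳ ∣ P ∣) ⟩
          ∣ P ∣                             ≤⟨ ∣∣≤length P⊆ ⟩
          length (elems A ++ missed)        ≡⟨ length-++ (elems A) ⟩
          length (elems A) + length missed  ≡⟨ cong₂ _+_ (length-elems A) (≡-sym (length-map (component (_∈? P)) missed)) ⟩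
          ∣ A ∣ + length (map (component (_∈? P)) missed) ∎
          where
          open ≤-Reasoning
          P⊆ : ∀ {x} → x ∈ P → x LM.∈ elems A ++ missed
          P⊆ {x} x∈ with x ∈? A
          ... | yes x∈A = LMP.∈-++⁺ˡ (∈-elems⁺ x∈A)
          ... | no x∉A = LMP.∈-++⁺ʳ (elems A) (∈-elems⁺ (∈⟪⟫⁺ P\A? (x∈ , x∉A)))
      go zero P P≤0 | A , (A⊆P , M) , A-max | yes (v , v∈ , _) =
        contradiction (≤-trans (≤-trans (s≤s z≤n) (x∈p⇒∣p-x∣<∣p∣ v∈)) P≤0) λ ()
      go (suc k) P P≤k | A , (A⊆P , M) , A-max | yes (v , v∈ , ¬avoidable)
        with go k (P - v) (≤-pred (≤-trans (x∈p⇒∣p-x∣<∣p∣ v∈) P≤k))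
      ... | F = record
                { A = A ; Y = ⟪ Y? ⟫ ; Cs = F.Cs ; A⊆P = A⊆P _ ; matching = M
                ; Y⊆P = λ w∈ → Y⊆ (∈⟪⟫⁻ Y? w∈)
                ; Cs-unique = F.Cs-unique
                ; Cs-odd = λ C∈ → respects-component to from (F.Cs-odd C∈)
                ; bound = bound }
        where
        module F = Formula F
        Y? : ∀ w → Dec (w ∈ F.Y ⊎ w ≡ v)
        Y? w = (w ∈? F.Y) ⊎-dec (w ≟ v)
        Y⊆ : ∀ {w} → w ∈ F.Y ⊎ w ≡ v → w ∈ P
        Y⊆ (inj₁ w∈) = x∈p-y⇒x∈p (F.Y⊆P w∈)
        Y⊆ (inj₂ refl) = v∈
        to : ∀ {w} → w ∈ P - v × w ∉ F.Y → w ∈ P × w ∉ ⟪ Y? ⟫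
        to (w∈ , w∉) = x∈p-y⇒x∈p w∈ , λ w∈Y → [ w∉ , x∈p-y⇒x≢y w∈ ]′ (∈⟪⟫⁻ Y? w∈Y)
        from : ∀ {w} → w ∈ P × w ∉ ⟪ Y? ⟫ → w ∈ P - v × w ∉ F.Y
        from (w∈ , w∉) = x∈p∧x≢y⇒x∈p-y w∈ (w∉ ∘ ∈⟪⟫⁺ Y? ∘ inj₂) , (w∉ ∘ ∈⟪⟫⁺ Y? ∘ inj₁)
        F<A : ∣ F.A ∣ < ∣ A ∣
        F<A = ≰⇒> λ A≤ → ¬avoidable (F.A , ((λ _ → F.A⊆P) , F.matching) , A≤)
        -- Deleting `v` lowers the maximum, and by parity lowers it by two. One unit pays for `v`
        -- leaving `P`, the other for `v` entering `Y`.
        bound : ∣ P ∣ + ∣ ⟪ Y? ⟫ ∣ ≤ ∣ A ∣ + length F.Cs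
        bound = begin
          ∣ P ∣ + ∣ ⟪ Y? ⟫ ∣              ≤⟨ +-mono-≤ (≤-reflexive (≡-sym (suc∣p-x∣≡∣p∣ v∈)))
                                              (∣p∣≤1+∣q∣ λ w∈ w≢v → [ id , (λ e → contradiction e w≢v) ]′ (∈⟪⟫⁻ Y? w∈)) ⟩
          suc ∣ P - v ∣ + suc ∣ F.Y ∣     ≡⟨ cong suc (+-suc ∣ P - v ∣ ∣ F.Y ∣) ⟩
          suc (suc (∣ P - v ∣ + ∣ F.Y ∣)) ≤⟨ s≤s (s≤s F.bound) ⟩
          suc (suc (∣ F.A ∣ + length F.Cs)) ≤⟨ +-monoˡ-≤ (length F.Cs) (even-gap (PM-size-even F.matching) (PM-size-even M) F<A) ⟩
          ∣ A ∣ + length F.Cs ∎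
          where open ≤-Reasoning

-- Barriers and their odd components

length-ends : {A : Set} (M : List (A × A)) → length (ends M) ≡ 2 * length M
length-ends [] = refl
length-ends (_ ∷ M) = trans (cong (λ m → ℕ.suc (ℕ.suc m)) (length-ends M))
  (cong ℕ.suc (≡-sym (+-suc (length M) (length M + 0))))

lookup-injective : {A : Set} {xs : List A} → Unique xs → ∀ {i j} → lookup xs i ≡ lookup xs j → i ≡ j
lookup-injective (_ ∷ _) {zero} {zero} _ = refl
lookup-injective {xs = x ∷ xs} (x∉ ∷ _) {zero} {suc j} eq = contradiction eq (All.lookup x∉ (LMP.∈-lookup {xs = xs} j))
lookup-injective {xs = x ∷ xs} (x∉ ∷ _) {suc i} {zero} eq = contradiction (≡-sym eq) (All.lookup x∉ (LMP.∈-lookup {xs = xs} i))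
lookup-injective (_ ∷ un) {suc i} {suc j} eq = cong suc (lookup-injective un eq)

module OddComponents {n : ℕ} (G : Graph n) where
  open TutteBerge G public

  component-closed : ∀ {P C u v} → Component P C → Star (λ a b → P b × a ~ b) u v → u ∈ C → v ∈ C
  component-closed _ ε u∈ = u∈
  component-closed c@(_ , _ , _ , closed) ((pb , a~b) ◅ s) u∈ = component-closed c s (closed _ _ u∈ pb a~b)

  component-⊆ : ∀ {P C D w} → Component P C → Component P D → w ∈ C → w ∈ D → C ⊆ D
  component-⊆ {P} {C} (C⊆P , _ , conn , _) cD w∈C w∈D v∈C = component-closed cD (weaken (conn _ _ w∈C v∈C)) w∈D
    where
    weaken : ∀ {a b} → Star (λ a b → a ∈ C × b ∈ C × T (adj G a b)) a b → Star (λ a b → P b × a ~ b) a b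
    weaken ε = ε
    weaken ((_ , b∈ , e) ◅ s) = (C⊆P _ b∈ , e) ◅ weaken s

  component-≡ : ∀ {P C D w} → Component P C → Component P D → w ∈ C → w ∈ D → C ≡ D
  component-≡ cC cD w∈C w∈D = ⊆-antisym (component-⊆ cC cD w∈C w∈D) (component-⊆ cD cC w∈D w∈C)

  abstract
    -- An edge leaving `C` ends in `Z`. If `N` had no such edge, it would match the odd set `C`
    -- within itself.
    exit : ∀ {Q Z C} (N : PM Q) → OddComponent (_∉ Z) C → (∀ {v} → v ∈ C → Q v) →
           Σ (Fin n) λ w → w ∈ C × mate N w ∈ Z
    exit {Z = Z} {C} N ((_ , _ , _ , closed) , odd) C⊆Q with any? (λ w → (w ∈? C) ×-dec (mate N w ∈? Z))
    ... | yes e = e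
    ... | no ¬e with trans (≡-sym odd) (PM-size-even (restrict N C⊆Q stays))
      where
      stays : ∀ {v} → v ∈ C → mate N v ∈ C
      stays v∈ = closed _ _ v∈ (λ m∈Z → ¬e (_ , v∈ , m∈Z)) (v~mate N (C⊆Q v∈))
    ... | ()

  -- Each component sends an edge of `N` to `Z`, and different components reach different vertices.
  -- The matching may cover only `Q`, so that the bound applies to `G` and also to `G` without two
  -- vertices; `Z′` contains the part of `Z` that is still covered.
  odd-components-bound : ∀ {Q Z Z′} (N : PM Q) L → Unique L →
    (∀ {C} → C LM.∈ L → OddComponent (_∉ Z) C × (∀ {v} → v ∈ C → Q v)) →
    (∀ {v} → v ∈ Z → Q v → v ∈ Z′) → length L ≤ ∣ Z′ ∣
  odd-components-bound {Q} {Z} {Z′} N L un odd Z⊆ with go L un odd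
    where
    go : ∀ L → Unique L → (∀ {C} → C LM.∈ L → OddComponent (_∉ Z) C × (∀ {v} → v ∈ C → Q v)) →
         Σ (List (Fin n)) λ zs → length zs ≡ length L × Unique zs ×
           (∀ {z} → z LM.∈ zs → z ∈ Z × Q z × Σ (Subset n) λ C → C LM.∈ L × mate N z ∈ C)
    go [] _ _ = [] , refl , [] , λ ()
    go (C ∷ L) (C∉ ∷ un) odd with go L un (odd ∘ there) | odd (here refl)
    ... | zs , len , un′ , info | oC , C⊆Q with exit N oC C⊆Q
    ...   | w , w∈ , mw∈Z = mate N w ∷ zs , cong suc len , AllP.¬Any⇒All¬ zs fresh ∷ un′ , info′
      where
      back : mate N (mate N w) ∈ C
      back = subst (_∈ C) (≡-sym (mate² N (C⊆Q w∈))) w∈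
      fresh : ¬ (mate N w LM.∈ zs)
      fresh z∈ with info z∈
      ... | _ , _ , D , D∈ , m∈D = All.lookup C∉ D∈ (component-≡ (proj₁ oC) (proj₁ (proj₁ (odd (there D∈)))) back m∈D)
      info′ : ∀ {z} → z LM.∈ mate N w ∷ zs → z ∈ Z × Q z × Σ (Subset n) λ D → D LM.∈ C ∷ L × mate N z ∈ D
      info′ (here refl) = mw∈Z , mate∈ N (C⊆Q w∈) , C , here refl , back
      info′ (there z∈) with info z∈
      ... | z∈Z , qz , D , D∈ , m∈ = z∈Z , qz , D , there D∈ , m∈
  ... | zs , len , un′ , info = ≤-trans (≤-reflexive (≡-sym len))
          (unique-⊆⇒length≤∣∣ un′ λ z∈ → Z⊆ (proj₁ (info z∈)) (proj₁ (proj₂ (info z∈))))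

module Barriers {n : ℕ} (G : Graph n) (M₀ : Factorizable ⟦ G ⟧)
                (X : Subset n) (X-odd-maximal : OddMaximal G X)
                (Ks : List (Subset n)) (Ks-odd : OddComps G X Ks) where
  open OddComponents G public

  abstract
    M : PM Whole
    M = factorizable⇒PM M₀

  ν : ℕ
  ν = proj₁ (proj₁ X-odd-maximal)

  isν : IsNu G ν
  isν = proj₁ (proj₂ (proj₁ X-odd-maximal))

  2ν≡n : 2 * ν ≡ n
  2ν≡n = ≤-antisym 2ν≤n n≤2ν
    where
    open ≤-Reasoning
    2ν≤n : 2 * ν ≤ n
    2ν≤n with isν
    ... | (N , (_ , N-unique) , N-length) , _ = begin
      2 * ν            ≡⟨ cong (2 *_) N-length ⟨
      2 * length N     ≡⟨ length-ends N ⟨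
      length (ends N)  ≤⟨ unique-⊆⇒length≤∣∣ {p = full} N-unique (λ _ → ∈⊤) ⟩
      ∣ full {n} ∣     ≡⟨ ∣⊤∣≡n n ⟩
      n                ∎
    n≤2ν : n ≤ 2 * ν
    n≤2ν = begin
      n                         ≡⟨ ∣⊤∣≡n n ⟨
      ∣ full {n} ∣              ≤⟨ ∣∣≤length {p = full} (λ {v} _ → proj₂ (proj₂ M₀) v) ⟩
      length (ends (proj₁ M₀))  ≡⟨ length-ends (proj₁ M₀) ⟩
      2 * length (proj₁ M₀)     ≤⟨ *-monoʳ-≤ 2 (proj₂ isν (proj₁ M₀) (proj₁ (proj₂ M₀))) ⟩
      2 * ν                     ∎

  l : ℕ
  l = length Ks

  Ks-unique : Unique Ks
  Ks-unique = proj₁ Ks-odd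

  Ks⇒odd : ∀ {C} → C LM.∈ Ks → OddComponent (_∉ X) C
  Ks⇒odd {C} = Equivalence.to (proj₂ Ks-odd C)

  -- With `2 * ν = n` the barrier equation reads `q = |X|`. It counts along the list `Ks′` of the
  -- certificate, which has the same members as `Ks`.
  l≡∣X∣ : l ≡ ∣ X ∣
  l≡∣X∣ with proj₂ (proj₂ (proj₁ X-odd-maximal))
  ... | Ks′ , (Ks′-unique , Ks′-odd) , len = trans (≤-antisym
          (unique-⊆⇒length≤ Ks-unique λ {C} C∈ → Equivalence.from (Ks′-odd C) (Equivalence.to (proj₂ Ks-odd C) C∈))
          (unique-⊆⇒length≤ Ks′-unique λ {C} C∈ → Equivalence.from (proj₂ Ks-odd C) (Equivalence.to (Ks′-odd C) C∈)))
          (+-cancelʳ-≡ n (length Ks′) ∣ X ∣ (trans (cong (length Ks′ +_) (≡-sym 2ν≡n)) (trans len (+-comm n ∣ X ∣))))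

  K : Fin l → Subset n
  K = lookup Ks

  K-odd : ∀ j → OddComponent (_∉ X) (K j)
  K-odd j = Ks⇒odd (LMP.∈-lookup {xs = Ks} j)

  K∩X : ∀ {j v} → v ∈ K j → v ∉ X
  K∩X {j} = proj₁ (proj₁ (K-odd j)) _

  K-closed : ∀ {j u v} → u ∈ K j → v ∉ X → u ~ v → v ∈ K j
  K-closed {j} u∈ v∉ e = proj₂ (proj₂ (proj₂ (proj₁ (K-odd j)))) _ _ u∈ v∉ e

  K-connected : ∀ {j u v} → u ∈ K j → v ∈ K j → Star (λ a b → a ∈ K j × b ∈ K j × a ~ b) u v
  K-connected {j} = proj₁ (proj₂ (proj₂ (proj₁ (K-odd j)))) _ _

  K-disjoint : ∀ {i j v} → v ∈ K i → v ∈ K j → i ≡ j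
  K-disjoint {i} {j} v∈i v∈j = lookup-injective Ks-unique (component-≡ (proj₁ (K-odd i)) (proj₁ (K-odd j)) v∈i v∈j)

  module Exits (N : PM Whole) where

    exitOf : Fin l → Fin n
    exitOf j = proj₁ (exit N (K-odd j) (λ _ → tt))

    exitOf∈ : ∀ j → exitOf j ∈ K j
    exitOf∈ j = proj₁ (proj₂ (exit N (K-odd j) (λ _ → tt)))

    σ : Fin l → Fin n
    σ j = mate N (exitOf j)

    σ∈ : ∀ j → σ j ∈ X
    σ∈ j = proj₂ (proj₂ (exit N (K-odd j) (λ _ → tt)))

    mate-σ : ∀ j → mate N (σ j) ≡ exitOf j
    mate-σ j = mate² N tt

    σ-injective : ∀ {i j} → σ i ≡ σ j → i ≡ j
    σ-injective {i} {j} eq = K-disjoint (exitOf∈ i)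
      (subst (_∈ K j) (trans (≡-sym (mate-σ j)) (trans (cong (mate N) (≡-sym eq)) (mate-σ i))) (exitOf∈ j))

    abstract
      -- A vertex `x` missed by the injective `σ` would give `l + 1` elements of `X`. Thus `N`
      -- matches all of `X` into odd components.
      σ-surjective : ∀ {x} → x ∈ X → Σ (Fin l) λ j → σ j ≡ x
      σ-surjective {x} x∈ with any? (λ j → σ j ≟ x)
      ... | yes e = e
      ... | no ¬e = contradiction (unique-⊆⇒length≤∣∣ {xs = x ∷ map σ (allFin l)}
                      (AllP.¬Any⇒All¬ _ fresh ∷ UP.map⁺ σ-injective (UP.allFin⁺ l)) ⊆X)
                      (<⇒≱ (s≤s (≤-reflexive (≡-sym (trans (length-map σ (allFin l)) (trans (length-tabulate id) l≡∣X∣))))))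
        where
        fresh : ¬ (x LM.∈ map σ (allFin l))
        fresh x∈L with LMP.∈-map⁻ σ x∈L
        ... | j , _ , refl = ¬e (j , refl)
        ⊆X : ∀ {y} → y LM.∈ x ∷ map σ (allFin l) → y ∈ X
        ⊆X (here refl) = x∈
        ⊆X (there y∈) with LMP.∈-map⁻ σ y∈
        ... | j , _ , refl = σ∈ j

    abstract
      -- The mate of `w` in `X` is some `σ i`, so `w` is `exitOf i`, and disjointness of the
      -- components gives `i = j`.
      exit-unique : ∀ {j w} → w ∈ K j → mate N w ∈ X → w ≡ exitOf j
      exit-unique {j} {w} w∈ m∈ with σ-surjective m∈
      ... | i , eq = trans w≡ (cong exitOf (K-disjoint (exitOf∈ i) (subst (_∈ K j) w≡ w∈)))
        where
        w≡ : w ≡ exitOf i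
        w≡ = trans (≡-sym (mate² N tt)) (trans (cong (mate N) (≡-sym eq)) (mate-σ i))

    abstract
      stays : ∀ {j w} → w ∈ K j → w ≢ exitOf j → mate N w ∈ K j
      stays w∈ w≢ = K-closed w∈ (w≢ ∘ exit-unique w∈) (v~mate N tt)

  -- The perfect matching `M` bounds any list of distinct odd components by `|Z|`. So `L` has
  -- exactly that length and is complete: one further component would exceed the bound.
  barrier-of-odd-components : ∀ Z L → Unique L → (∀ {C} → C LM.∈ L → OddComponent (_∉ Z) C) → ∣ Z ∣ ≤ length L → Barrier G Z
  barrier-of-odd-components Z L L-unique L-odd Z≤L =
    ν , isν , L , (L-unique , λ C → mk⇔ (λ C∈ → L-odd C∈) (all-of C)) ,
    trans (cong₂ _+_ (≤-antisym (L≤ L L-unique L-odd) Z≤L) 2ν≡n) (+-comm ∣ Z ∣ n)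
    where
    open import Data.List.Membership.DecPropositional (≡-dec {n = n} Data.Bool._≟_) using () renaming (_∈?_ to _∈L?_)
    L≤ : ∀ L → Unique L → (∀ {C} → C LM.∈ L → OddComponent (_∉ Z) C) → length L ≤ ∣ Z ∣
    L≤ L un odd = odd-components-bound {Z = Z} M L un (λ C∈ → odd C∈ , λ _ → tt) (λ z∈ _ → z∈)
    all-of : ∀ C → OddComponent (_∉ Z) C → C LM.∈ L
    all-of C oC with C ∈L? L
    ... | yes C∈ = C∈
    ... | no C∉ = contradiction Z≤L (<⇒≱ (L≤ (C ∷ L) (AllP.¬Any⇒All¬ L C∉ ∷ L-unique)
                    λ { (here refl) → oC ; (there C∈) → L-odd C∈ }))

  ∣p∪q∣≤ : ∀ (p q : Subset n) → ∣ p ∪ q ∣ ≤ ∣ p ∣ + ∣ q ∣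
  ∣p∪q∣≤ p q = ≤-trans (∣∣≤length p∪q⊆) (≤-reflexive (trans (length-++ (elems p)) (cong₂ _+_ (length-elems p) (length-elems q))))
    where
    p∪q⊆ : ∀ {x} → x ∈ p ∪ q → x LM.∈ elems p ++ elems q
    p∪q⊆ x∈ with x∈p∪q⁻ p q x∈
    ... | inj₁ x∈p = LMP.∈-++⁺ˡ (∈-elems⁺ x∈p)
    ... | inj₂ x∈q = LMP.∈-++⁺ʳ (elems p) (∈-elems⁺ x∈q)

  abstract
    K-factor-critical : ∀ j {v} → v ∈ K j → PM (λ w → w ∈ K j × w ≢ v)
    K-factor-critical j {v} v∈ with PM-dec (λ w → (w ∈? K j) ×-dec ¬? (w ≟ v))
    ... | yes N = N
    ... | no ¬N = contradiction barrier (proj₂ X-odd-maximal Y Y⊆DX (v , ∈⟪⟫⁺ Y? (inj₂ refl)))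
      where
      P? : ∀ w → Dec (w ∈ K j × w ≢ v)
      P? w = (w ∈? K j) ×-dec ¬? (w ≟ v)
      P : Subset n
      P = ⟪ P? ⟫
      module F = Formula (tutte-berge P)

      A<P : ∣ F.A ∣ < ∣ P ∣
      A<P = ≰⇒> λ P≤A → ¬N (respects (λ w∈ → ∈⟪⟫⁻ P? (F.A⊆P w∈)) (λ p → P⊆A P≤A (∈⟪⟫⁺ P? p)) F.matching)
        where
        P⊆A : ∣ P ∣ ≤ ∣ F.A ∣ → ∀ {w} → w ∈ P → w ∈ F.A
        P⊆A P≤A {w} w∈ with w ∈? F.A
        ... | yes w∈A = w∈A
        ... | no w∉A = contradiction P≤A (<⇒≱ (∣p∣<∣q∣ F.A⊆P w∈ w∉A))

      P-size : suc ∣ P ∣ ≡ ∣ K j ∣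
      P-size = suc∣p∣≡∣q∣ (proj₁ ∘ ∈⟪⟫⁻ P?) v∈ (λ v∈P → proj₂ (∈⟪⟫⁻ P? v∈P) refl) (λ w∈ w≢v → ∈⟪⟫⁺ P? (w∈ , w≢v))

      P-even : ∣ P ∣ % 2 ≡ 0
      P-even with even⊎odd ∣ P ∣
      ... | inj₁ e = e
      ... | inj₂ o with trans (≡-sym (proj₂ (K-odd j))) (trans (cong (_% 2) (≡-sym P-size)) (odd-suc ∣ P ∣ o))
        where
        odd-suc : ∀ m → m % 2 ≡ 1 → suc m % 2 ≡ 0
        odd-suc (suc zero) _ = refl
        odd-suc (suc (suc m)) o = odd-suc m o
      ... | ()

      -- `K j - v` has even size and so has every matched set, so the deficiency is at least two.
      many : suc (suc ∣ F.Y ∣) ≤ length F.Cs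
      many = +-cancelˡ-≤ ∣ F.A ∣ _ _ (begin
        ∣ F.A ∣ + suc (suc ∣ F.Y ∣)   ≡⟨ trans (+-suc ∣ F.A ∣ _) (cong suc (+-suc ∣ F.A ∣ _)) ⟩
        suc (suc ∣ F.A ∣) + ∣ F.Y ∣   ≤⟨ +-monoˡ-≤ ∣ F.Y ∣ (even-gap (PM-size-even F.matching) P-even A<P) ⟩
        ∣ P ∣ + ∣ F.Y ∣               ≤⟨ F.bound ⟩
        ∣ F.A ∣ + length F.Cs         ∎)
        where open ≤-Reasoning

      Y? : ∀ w → Dec (w ∈ F.Y ⊎ w ≡ v)
      Y? w = (w ∈? F.Y) ⊎-dec (w ≟ v)
      Y : Subset n
      Y = ⟪ Y? ⟫

      Y⊆K : ∀ {w} → w ∈ Y → w ∈ K j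
      Y⊆K w∈ with ∈⟪⟫⁻ Y? w∈
      ... | inj₁ w∈Y = proj₁ (∈⟪⟫⁻ P? (F.Y⊆P w∈Y))
      ... | inj₂ refl = v∈

      Y⊆DX : ∀ w → w ∈ Y → DX G X w
      Y⊆DX w w∈ = K j , proj₁ (K-odd j) , proj₂ (K-odd j) , Y⊆K w∈

      other? : ∀ C → Dec (¬ C ≡ K j)
      other? C = ¬? (≡-dec Data.Bool._≟_ C (K j))

      others L : List (Subset n)
      others = filter other? Ks
      L = others ++ F.Cs

      Cs⊆K : ∀ {C w} → C LM.∈ F.Cs → w ∈ C → w ∈ K j
      Cs⊆K C∈ w∈ = proj₁ (∈⟪⟫⁻ P? (proj₁ (proj₁ (proj₁ (F.Cs-odd C∈)) _ w∈)))

      others∩K : ∀ {C w} → C LM.∈ others → w ∈ C → w ∉ K j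
      others∩K C∈ w∈C w∈K with LMP.∈-filter⁻ other? {xs = Ks} C∈
      ... | C∈Ks , C≢ = C≢ (component-≡ (proj₁ (Ks⇒odd C∈Ks)) (proj₁ (K-odd j)) w∈C w∈K)

      L-unique : Unique L
      L-unique = UP.++⁺ (UP.filter⁺ other? Ks-unique) F.Cs-unique
        λ (C∈ , C∈′) → let w , w∈ = proj₁ (proj₂ (proj₁ (F.Cs-odd C∈′))) in others∩K C∈ w∈ (Cs⊆K C∈′ w∈)

      L-odd : ∀ {C} → C LM.∈ L → OddComponent (_∉ X ∪ Y) C
      L-odd {C} C∈ with LMP.∈-++⁻ others C∈
      ... | inj₁ C∈o with Ks⇒odd (proj₁ (LMP.∈-filter⁻ other? {xs = Ks} C∈o))
      ...   | (C∩X , ne , conn , closed) , odd =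
              ((λ w w∈C w∈XY → [ C∩X w w∈C , others∩K C∈o w∈C ∘ Y⊆K ]′ (x∈p∪q⁻ X Y w∈XY)) , ne , conn ,
               λ u w u∈ w∉ → closed u w u∈ (w∉ ∘ x∈p∪q⁺ ∘ inj₁)) , odd
      L-odd {C} C∈ | inj₂ C∈Cs with F.Cs-odd C∈Cs
      ...   | (C⊆ , ne , conn , closed) , odd = (avoids , ne , conn , closed′) , odd
        where
        avoids : ∀ w → w ∈ C → w ∉ X ∪ Y
        avoids w w∈ w∈XY with x∈p∪q⁻ X Y w∈XY
        ... | inj₁ w∈X = K∩X (Cs⊆K C∈Cs w∈) w∈X
        ... | inj₂ w∈Y with ∈⟪⟫⁻ Y? w∈Y
        ...   | inj₁ w∈FY = proj₂ (C⊆ w w∈) w∈FY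
        ...   | inj₂ w≡v = proj₂ (∈⟪⟫⁻ P? (proj₁ (C⊆ w w∈))) w≡v
        closed′ : ∀ u w → u ∈ C → w ∉ X ∪ Y → u ~ w → w ∈ C
        closed′ u w u∈ w∉ u~w = closed u w u∈
          (∈⟪⟫⁺ P? (K-closed (Cs⊆K C∈Cs u∈) (w∉ ∘ x∈p∪q⁺ ∘ inj₁) u~w , w∉ ∘ x∈p∪q⁺ ∘ inj₂ ∘ ∈⟪⟫⁺ Y? ∘ inj₂) ,
           w∉ ∘ x∈p∪q⁺ {p = X} ∘ inj₂ ∘ ∈⟪⟫⁺ Y? ∘ inj₁) u~w

      l≤ : ∣ X ∣ ≤ suc (length others)
      l≤ = ≤-trans (≤-reflexive (≡-sym l≡∣X∣)) (unique-⊆⇒length≤ Ks-unique Ks⊆)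
        where
        Ks⊆ : ∀ {C} → C LM.∈ Ks → C LM.∈ K j ∷ others
        Ks⊆ {C} C∈ with ≡-dec Data.Bool._≟_ C (K j)
        ... | yes refl = here refl
        ... | no C≢ = there (LMP.∈-filter⁺ other? C∈ C≢)

      -- The balance is exact: the list loses `K j` and gains at least `|F.Y| + 2` components, while
      -- `X` grows by `F.Y` and `v`.
      L-long : ∣ X ∪ Y ∣ ≤ length L
      L-long = begin
        ∣ X ∪ Y ∣                            ≤⟨ ∣p∪q∣≤ X Y ⟩
        ∣ X ∣ + ∣ Y ∣                        ≤⟨ +-mono-≤ l≤ (∣p∣≤1+∣q∣ λ w∈ w≢v → [ id , (λ e → contradiction e w≢v) ]′ (∈⟪⟫⁻ Y? w∈)) ⟩
        suc (length others) + suc ∣ F.Y ∣    ≡⟨ +-suc (length others) (suc ∣ F.Y ∣) ⟨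
        length others + suc (suc ∣ F.Y ∣)    ≤⟨ +-monoʳ-≤ (length others) many ⟩
        length others + length F.Cs          ≡⟨ length-++ others ⟨
        length L                             ∎
        where open ≤-Reasoning

      barrier : Barrier G (X ∪ Y)
      barrier = barrier-of-odd-components (X ∪ Y) L L-unique L-odd L-long

-- The Dulmage–Mendelsohn decomposition of the bipartite reduction

abstract
  injection⇒surjection : ∀ {l} (f : Fin l → Fin l) → (∀ {a b} → f a ≡ f b → a ≡ b) → ∀ b → Σ (Fin l) λ a → f a ≡ b
  injection⇒surjection f f-inj b = last (b , refl) (injection-returns f f-inj b)
    where
    last : ∀ {x y} → Σ _ (λ a → f a ≡ x) → Star (λ a b → f a ≡ b) x y → Σ _ λ a → f a ≡ y
    last e ε = e
    last _ (e ◅ s) = last (_ , e) s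

module _ {l : ℕ} (a b : Fin l) where

  swap : Fin l → Fin l
  swap x with x ≟ a | x ≟ b
  ... | yes _ | _ = b
  ... | no _ | yes _ = a
  ... | no _ | no _ = x

  swap-left : swap a ≡ b
  swap-left with a ≟ a | a ≟ b
  ... | yes _ | _ = refl
  ... | no a≢a | _ = contradiction refl a≢a

  swap-right : swap b ≡ a
  swap-right with b ≟ a | b ≟ b
  ... | yes b≡a | _ = b≡a
  ... | no _ | yes _ = refl
  ... | no _ | no b≢b = contradiction refl b≢b

  swap-other : ∀ {x} → x ≢ a → x ≢ b → swap x ≡ x
  swap-other {x} x≢a x≢b with x ≟ a | x ≟ b
  ... | yes x≡a | _ = contradiction x≡a x≢a
  ... | no _ | yes x≡b = contradiction x≡b x≢b
  ... | no _ | no _ = refl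

  swap² : ∀ x → swap (swap x) ≡ x
  swap² x = by-cases (x ≟ a) (x ≟ b)
    where
    by-cases : Dec (x ≡ a) → Dec (x ≡ b) → swap (swap x) ≡ x
    by-cases (yes refl) _ = trans (cong swap swap-left) swap-right
    by-cases (no _) (yes refl) = trans (cong swap swap-right) swap-left
    by-cases (no x≢a) (no x≢b) = trans (cong swap (swap-other x≢a x≢b)) (swap-other x≢a x≢b)

  swap-injective : ∀ {x y} → swap x ≡ swap y → x ≡ y
  swap-injective {x} {y} eq = trans (≡-sym (swap² x)) (trans (cong swap eq) (swap² y))

module _ {l : ℕ} {R : Fin l → Fin l → Set} where

  data SimplePath (j : Fin l) : Fin l → List (Fin l) → Set where
    stop : SimplePath j j (j ∷ [])
    step : ∀ {k k′ vs} → R k k′ → ¬ (k LM.∈ vs) → SimplePath j k′ vs → SimplePath j k (k ∷ vs)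

  simple-suffix : ∀ {j k vs w} → SimplePath j k vs → w LM.∈ vs → Σ (List (Fin l)) (SimplePath j w)
  simple-suffix p@stop (here refl) = _ , p
  simple-suffix p@(step _ _ _) (here refl) = _ , p
  simple-suffix (step _ _ p) (there w∈) = simple-suffix p w∈

  star⇒simple : ∀ {j k} → Star R k j → Σ (List (Fin l)) (SimplePath j k)
  star⇒simple ε = _ , stop
  star⇒simple {k = k} (r ◅ s) with star⇒simple s
  ... | vs , p with Any.any? (k ≟_) vs
  ...   | yes k∈ = simple-suffix p k∈
  ...   | no k∉ = _ , step r k∉ p

  simple-head : ∀ {j k vs} → SimplePath j k vs → k LM.∈ vs
  simple-head stop = here refl
  simple-head (step _ _ _) = here refl

  -- The plan of a new matching: each `K i` with `i ≢ j` is to be matched to `σ (π i)`. The value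
  -- `π j = k` marks what stays free, `σ k` and one vertex of `K j`, so no arrow from `j` to `k` is
  -- asked for.
  record Rerouting (j k : Fin l) : Set where
    field
      π : Fin l → Fin l
      π-injective : ∀ {a b} → π a ≡ π b → a ≡ b
      π-end : π j ≡ k
      π-step : ∀ {i} → i ≢ j → R i (π i)

  module _ (R-refl : ∀ i → R i i) where

    -- Shifts every vertex of the path to its successor and closes the cycle with j ↦ k.
    simple⇒rerouting : ∀ {j k vs} → SimplePath j k vs →
      Σ (Rerouting j k) λ ρ → ∀ {i} → ¬ (i LM.∈ vs) → Rerouting.π ρ i ≡ i
    simple⇒rerouting stop = record { π = id ; π-injective = id ; π-end = refl ; π-step = λ _ → R-refl _ } , λ _ → refl
    simple⇒rerouting {j} {k} (step {k′ = k′} {vs = vs} r k∉ p) with simple⇒rerouting p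
    ... | ρ , off = record
            { π = swap k k′ ∘ π ; π-injective = π-injective ∘ swap-injective k k′
            ; π-end = trans (cong (swap k k′) π-end) (swap-right k k′) ; π-step = π-step′ }
          , λ {i} i∉ → trans (cong (swap k k′) (off (i∉ ∘ there)))
                         (swap-other k k′ (λ { refl → i∉ (here refl) }) λ { refl → i∉ (there (simple-head p)) })
      where
      open Rerouting ρ
      -- Only `k`, being off the remaining path, is sent to `k` by `π`, and it is redirected to `k′`
      -- along `r`. Only `j` is sent to `k′`, and `j` is exempt.
      π-step′ : ∀ {i} → i ≢ j → R i (swap k k′ (π i))
      π-step′ {i} i≢j = by-cases (π i ≟ k)
        where
        by-cases : Dec (π i ≡ k) → R i (swap k k′ (π i))
        by-cases (yes πi≡k) = subst₂ R (π-injective (trans (off k∉) (≡-sym πi≡k))) (≡-sym (trans (cong (swap k k′) πi≡k) (swap-left k k′))) r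
        by-cases (no πi≢k) = subst (R i) (≡-sym (swap-other k k′ πi≢k λ πi≡k′ → i≢j (π-injective (trans πi≡k′ (≡-sym π-end))))) (π-step i≢j)

    star⇒rerouting : ∀ {j k} → Star R k j → Rerouting j k
    star⇒rerouting s = proj₁ (simple⇒rerouting (proj₂ (star⇒simple s)))

module _ {n : ℕ} (G : Graph n) where
  open Matchings G

  union-family : ∀ {l} {P : Fin l → Fin n → Set} → (∀ j v → Dec (P j v)) → (∀ j → PM (P j)) →
                 (∀ {i j v} → P i v → P j v → i ≡ j) → PM (λ v → Σ (Fin l) λ j → P j v)
  union-family {l} {P} P? N disjoint = record
    { mate = m
    ; mate∈ = λ (j , p) → j , subst (P j) (≡-sym (m-eq p)) (mate∈ (N j) p)
    ; mate² = λ (j , p) → trans (cong m (m-eq p)) (trans (m-eq (mate∈ (N j) p)) (mate² (N j) p))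
    ; v~mate = λ {v} (j , p) → subst (v ~_) (≡-sym (m-eq p)) (v~mate (N j) p) }
    where
    m : Fin n → Fin n
    m v with any? (λ j → P? j v)
    ... | yes (j , _) = mate (N j) v
    ... | no _ = v
    m-eq : ∀ {j v} → P j v → m v ≡ mate (N j) v
    m-eq {j} {v} p with any? (λ j → P? j v)
    ... | yes (i , q) = cong (λ i → mate (N i) v) (disjoint q p)
    ... | no ¬∃ = contradiction (j , p) ¬∃

module Reduction {n : ℕ} (G : Graph n) (M₀ : Factorizable ⟦ G ⟧)
                 (X : Subset n) (X-odd-maximal : OddMaximal G X)
                 (Ks : List (Subset n)) (Ks-odd : OddComps G X Ks) where
  open Barriers G M₀ X X-odd-maximal Ks Ks-odd public
  open Exits M public

  Arrow : Fin l → Fin l → Set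
  Arrow j k = Σ (Fin n) λ w → w ∈ K j × w ~ σ k

  arrow? : ∀ j k → Dec (Arrow j k)
  arrow? j k = any? λ w → (w ∈? K j) ×-dec T? (adj G w (σ k))

  arrow-refl : ∀ j → Arrow j j
  arrow-refl j = exitOf j , exitOf∈ j , v~mate M tt

  Reach : Fin l → Fin l → Set
  Reach = Star Arrow

  reach? : ∀ j k → Dec (Reach j k)
  reach? = star? arrow?

  module _ {j₀ k₀} (ρ : Rerouting {R = Arrow} j₀ k₀) {v₀} (v₀∈ : v₀ ∈ K j₀) where
    open Rerouting ρ

    private
      Piece : Fin l → Fin n → Set
      Piece j w = (w ∈ K j × ¬ (j ≡ j₀ × w ≡ v₀)) ⊎ (w ≡ σ (π j) × j ≢ j₀)

      piece? : ∀ j w → Dec (Piece j w)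
      piece? j w = ((w ∈? K j) ×-dec ¬? ((j ≟ j₀) ×-dec (w ≟ v₀))) ⊎-dec ((w ≟ σ (π j)) ×-dec ¬? (j ≟ j₀))

      -- The arrow from `j` to `π j` supplies an edge `u σ(π j)` with `u` in `K j`, and
      -- factor-criticality matches `K j - u`; at `j₀` it matches `K j₀ - v₀` directly.
      piece-PM : ∀ j → PM (Piece j)
      piece-PM j with j ≟ j₀
      ... | yes refl = respects {P = λ w → w ∈ K j × w ≢ v₀} (λ (w∈ , w≢) → inj₁ (w∈ , w≢ ∘ proj₂))
                (λ { (inj₁ (w∈ , ¬both)) → w∈ , λ w≡ → ¬both (refl , w≡) ; (inj₂ (_ , j≢j)) → contradiction refl j≢j })
                (K-factor-critical j v₀∈)
      ... | no j≢ with π-step j≢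
      ...   | u , u∈ , u~ = add-edge (K-factor-critical j u∈) u~ (λ (_ , u≢u) → u≢u refl) (λ (s∈ , _) → K∩X s∈ (σ∈ (π j)))
                split (λ (w∈ , _) → inj₁ (w∈ , j≢ ∘ proj₁)) (inj₁ (u∈ , j≢ ∘ proj₁)) (inj₂ (refl , j≢))
        where
        split : ∀ {w} → Piece j w → (w ∈ K j × w ≢ u) ⊎ (w ≡ u ⊎ w ≡ σ (π j))
        split (inj₂ (w≡ , _)) = inj₂ (inj₂ w≡)
        split {w} (inj₁ (w∈ , _)) with w ≟ u
        ... | yes w≡u = inj₂ (inj₁ w≡u)
        ... | no w≢u = inj₁ (w∈ , w≢u)

      piece-disjoint : ∀ {i j w} → Piece i w → Piece j w → i ≡ j
      piece-disjoint (inj₁ (w∈i , _)) (inj₁ (w∈j , _)) = K-disjoint w∈i w∈j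
      piece-disjoint (inj₁ (w∈i , _)) (inj₂ (refl , _)) = contradiction (σ∈ _) (K∩X w∈i)
      piece-disjoint (inj₂ (refl , _)) (inj₁ (w∈j , _)) = contradiction (σ∈ _) (K∩X w∈j)
      piece-disjoint (inj₂ (refl , _)) (inj₂ (eq , _)) = π-injective (σ-injective eq)

      Even : Fin n → Set
      Even w = w ∉ X × (∀ j → w ∉ K j)

      -- The even components keep `M`: since `σ` is onto `X`, no edge of `M` joins them to `X`.
      even-PM : PM Even
      even-PM = restrict M (λ _ → tt) λ {w} (w∉X , w∉K) →
        (λ m∈X → let j , σj≡ = σ-surjective m∈X in
          w∉K j (subst (_∈ K j) (trans (≡-sym (mate-σ j)) (trans (cong (mate M) σj≡) (mate² M tt))) (exitOf∈ j))) ,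
        λ j m∈K → w∉K j (K-closed m∈K w∉X (~-sym (v~mate M tt)))

      cover : ∀ {w} → w ≢ σ k₀ × w ≢ v₀ → (Σ (Fin l) λ j → Piece j w) ⊎ Even w
      cover {w} (w≢σ , w≢v₀) with w ∈? X
      ... | yes w∈X with σ-surjective w∈X
      ...   | k , refl with injection⇒surjection π π-injective k
      ...     | j , refl = inj₁ (j , inj₂ (refl , λ { refl → w≢σ (cong σ π-end) }))
      cover {w} (w≢σ , w≢v₀) | no w∉X with any? (λ j → w ∈? K j)
      ...   | yes (j , w∈) = inj₁ (j , inj₁ (w∈ , w≢v₀ ∘ proj₂))
      ...   | no ¬∃ = inj₂ (w∉X , λ j w∈ → ¬∃ (j , w∈))

      pieces⊆ : ∀ {w} → (Σ (Fin l) λ j → Piece j w) → w ≢ σ k₀ × w ≢ v₀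
      pieces⊆ (j , inj₁ (w∈ , ¬both)) = (λ { refl → K∩X w∈ (σ∈ k₀) }) , λ { refl → ¬both (K-disjoint w∈ v₀∈ , refl) }
      pieces⊆ (j , inj₂ (refl , j≢)) = (λ eq → j≢ (π-injective (trans (σ-injective eq) (≡-sym π-end)))) ,
                                       λ { refl → K∩X v₀∈ (σ∈ (π j)) }

    rerouted-PM : PM (λ w → w ≢ σ k₀ × w ≢ v₀)
    rerouted-PM = union (λ w → any? λ j → piece? j w) (union-family G piece? piece-PM piece-disjoint) even-PM
      (λ { (j , inj₁ (w∈ , _)) (_ , w∉K) → w∉K j w∈ ; (j , inj₂ (refl , _)) (w∉X , _) → w∉X (σ∈ (π j)) })
      cover pieces⊆ (λ (w∉X , w∉K) → (λ { refl → w∉X (σ∈ k₀) }) , λ { refl → w∉K j₀ v₀∈ })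

  abstract
    reach⇒PM : ∀ {j k v} → Reach k j → v ∈ K j → PM (λ w → w ≢ σ k × w ≢ v)
    reach⇒PM r = rerouted-PM (star⇒rerouting arrow-refl r)

  module _ {π : Fin l → Fin l} (π-injective : ∀ {a b} → π a ≡ π b → a ≡ b) (π-arrow : ∀ i → Arrow i (π i)) where

    permutation-returns : ∀ j → Reach (π j) j
    permutation-returns j = arrows (injection-returns π π-injective j)
      where
      arrows : ∀ {a b} → Star (λ a b → π a ≡ b) a b → Reach a b
      arrows ε = ε
      arrows (refl ◅ s) = π-arrow _ ◅ arrows s

  module _ (N : PM Whole) where
    private
      module N = Exits N

      π : Fin l → Fin l
      π j = proj₁ (σ-surjective (N.σ∈ j))

      σπ : ∀ j → σ (π j) ≡ N.σ j
      σπ j = proj₂ (σ-surjective (N.σ∈ j))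

    abstract
      -- The converse of rerouting. Relative to `σ`, the exits of `N` define a permutation of the
      -- indices whose steps are arrows; `w` is the exit of `K j`, so `k` is the successor of `j`,
      -- and the cycle returns from `k` to `j`.
      crossing-edge : ∀ {j k w} → w ∈ K j → mate N w ≡ σ k → Arrow j k × Reach k j
      crossing-edge {j} {k} {w} w∈ m≡ = (w , w∈ , subst (w ~_) m≡ (v~mate N tt)) ,
        subst (λ k → Reach k j) (σ-injective (trans (σπ j) (trans (cong (mate N) (≡-sym w≡)) m≡)))
          (permutation-returns (λ {a} {b} eq → N.σ-injective (trans (≡-sym (σπ a)) (trans (cong σ eq) (σπ b))))
            (λ i → N.exitOf i , N.exitOf∈ i , subst (N.exitOf i ~_) (≡-sym (σπ i)) (v~mate N tt)) j)
        where
        w≡ : w ≡ N.exitOf j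
        w≡ = N.exit-unique w∈ (subst (_∈ X) (≡-sym m≡) (σ∈ k))

  crossing-allowed : ∀ {j k w} → Reach k j → w ∈ K j → w ~ σ k → Allowed ⟦ G ⟧ (σ k) w
  crossing-allowed r w∈ e = edge-allowed (~-sym e) (reach⇒PM r w∈)

  𝓑 : Gr
  𝓑 = GX G X Ks

  𝓑-sym : ∀ {a b} → E 𝓑 a b → E 𝓑 b a
  𝓑-sym {inj₁ _} {inj₂ _} e = e
  𝓑-sym {inj₂ _} {inj₁ _} e = e

  𝓑-irrefl : ∀ {a} → ¬ E 𝓑 a a
  𝓑-irrefl {inj₁ _} ()
  𝓑-irrefl {inj₂ _} ()

  𝓑-finite : Finite (V 𝓑)
  𝓑-finite = finite-⊎ (finite-Σ (finite-Fin n) (_∈? X) ∈-irrelevant) (finite-Fin l)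

  -- `M` joins `σ k` to `K k`, so these two vertices of `𝓑` always lie in one DM-component and may
  -- share an index.
  idx : V 𝓑 → Fin l
  idx (inj₁ (_ , x∈)) = proj₁ (σ-surjective x∈)
  idx (inj₂ j) = j

  σ-vertex : Fin l → V 𝓑
  σ-vertex k = inj₁ (σ k , σ∈ k)

  vertex-≡ : ∀ {x y} (p : x ∈ X) (q : y ∈ X) → x ≡ y → _≡_ {A = V 𝓑} (inj₁ (x , p)) (inj₁ (y , q))
  vertex-≡ p q refl = cong (λ r → inj₁ (_ , r)) (∈-irrelevant p q)

  idx-σ : ∀ {x} (p : x ∈ X) → σ-vertex (idx (inj₁ (x , p))) ≡ inj₁ (x , p)
  idx-σ p = vertex-≡ _ p (proj₂ (σ-surjective p))

  SC : Fin l → Fin l → Set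
  SC j k = Reach j k × Reach k j

  sc? : ∀ j k → Dec (SC j k)
  sc? j k = reach? j k ×-dec reach? k j

  sc-refl : ∀ {j} → SC j j
  sc-refl = ε , ε

  sc-sym : ∀ {j k} → SC j k → SC k j
  sc-sym (a , b) = b , a

  sc-trans : ∀ {i j k} → SC i j → SC j k → SC i k
  sc-trans (a , b) (c , d) = a ◅◅ c , d ◅◅ b

  module _ (F : Pairing 𝓑) where
    private
      opposite : ∀ {i z} → E 𝓑 (inj₂ i) z → Σ (Fin l) λ k → idx z ≡ k × z ≡ σ-vertex k × Arrow i k
      opposite {i} {inj₁ (x , p)} (w , w∈ , x~w) with σ-surjective p
      ... | k , refl = k , refl , vertex-≡ p (σ∈ k) refl , w , w∈ , ~-sym x~w

      π : Fin l → Fin l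
      π i = proj₁ (opposite (v~partner F (inj₂ i)))

      idx-π : ∀ i → idx (partner F (inj₂ i)) ≡ π i
      idx-π i = proj₁ (proj₂ (opposite (v~partner F (inj₂ i))))

      π-vertex : ∀ i → partner F (inj₂ i) ≡ σ-vertex (π i)
      π-vertex i = proj₁ (proj₂ (proj₂ (opposite (v~partner F (inj₂ i)))))

      π-arrow : ∀ i → Arrow i (π i)
      π-arrow i = proj₂ (proj₂ (proj₂ (opposite (v~partner F (inj₂ i)))))

      π-injective : ∀ {a b} → π a ≡ π b → a ≡ b
      π-injective {a} {b} eq = inj₂-injective (trans (≡-sym (partner² F (inj₂ a)))
        (trans (cong (partner F) (trans (π-vertex a) (trans (cong σ-vertex eq) (≡-sym (π-vertex b))))) (partner² F (inj₂ b))))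
        where
        inj₂-injective : ∀ {a b : Fin l} → _≡_ {A = V 𝓑} (inj₂ a) (inj₂ b) → a ≡ b
        inj₂-injective refl = refl

      forward : ∀ i → SC i (idx (partner F (inj₂ i)))
      forward i = subst (SC i) (≡-sym (idx-π i)) ((π-arrow i ◅ ε) , permutation-returns π-injective π-arrow i)

    -- The permutation argument for matchings of `𝓑` itself, without lifting them to `G`.
    pairing-sc : ∀ v → SC (idx v) (idx (partner F v))
    pairing-sc (inj₂ i) = forward i
    pairing-sc v@(inj₁ _) = by-cases (partner F v) refl (v~partner F v)
      where
      by-cases : ∀ z → partner F v ≡ z → E 𝓑 v z → SC (idx v) (idx z)
      by-cases (inj₂ j) eq _ = sc-sym (subst (λ u → SC j (idx u)) (trans (cong (partner F) (≡-sym eq)) (partner² F v)) (forward j))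

  abstract
    FC⇒sc : ∀ {a b} → FC 𝓑 a b → SC (idx a) (idx b)
    FC⇒sc ε = sc-refl
    FC⇒sc {a} ((N , joined) ◅ s) with toPairing (λ {a} {b} → 𝓑-sym {a} {b}) N
    ... | F , eq = sc-trans (subst (λ b → SC (idx a) (idx b)) (eq joined) (pairing-sc F a)) (FC⇒sc s)

  module _ (N : PM Whole) where
    private
      module N = Exits N

      p : V 𝓑 → V 𝓑
      p (inj₁ (x , x∈)) = inj₂ (proj₁ (N.σ-surjective x∈))
      p (inj₂ j) = inj₁ (N.σ j , N.σ∈ j)

      p² : ∀ v → p (p v) ≡ v
      p² (inj₁ (x , x∈)) = vertex-≡ _ x∈ (proj₂ (N.σ-surjective x∈))
      p² (inj₂ j) = cong inj₂ (N.σ-injective (proj₂ (N.σ-surjective (N.σ∈ j))))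

      edge : ∀ j → N.σ j ~ N.exitOf j
      edge j = ~-sym (v~mate N tt)

      v~p : ∀ v → E 𝓑 v (p v)
      v~p (inj₁ (x , x∈)) with N.σ-surjective x∈
      ... | j , refl = N.exitOf j , N.exitOf∈ j , edge j
      v~p (inj₂ j) = N.exitOf j , N.exitOf∈ j , edge j

    -- Each odd component has exactly one exit under `N`, so contracting the components turns `N`
    -- into a perfect matching of `𝓑`.
    project : Pairing 𝓑
    project = record { partner = p ; partner² = p² ; v~partner = v~p }

    project-allowed : ∀ j → Allowed 𝓑 (inj₂ j) (inj₁ (N.σ j , N.σ∈ j))
    project-allowed j with fromPairing 𝓑-finite (λ {a} → 𝓑-irrefl {a}) project
    ... | L , joined = L , joined (inj₂ j)

  allowed-swap : ∀ {a b} → Allowed 𝓑 a b → Allowed 𝓑 b a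
  allowed-swap (L , inj₁ e) = L , inj₂ e
  allowed-swap (L , inj₂ e) = L , inj₁ e

  FC-sym : ∀ {a b} → FC 𝓑 a b → FC 𝓑 b a
  FC-sym ε = ε
  FC-sym (e ◅ s) = FC-sym s ◅◅ (allowed-swap e ◅ ε)

  σ-to-K : ∀ j → FC 𝓑 (σ-vertex j) (inj₂ j)
  σ-to-K j = allowed-swap (project-allowed M j) ◅ ε

  -- The edge behind the arrow is completed to a perfect matching of `G` by rerouting, and that
  -- matching is projected to `𝓑`.
  arrow⇒FC : ∀ {i k} → Arrow i k → Reach k i → FC 𝓑 (inj₂ i) (inj₂ k)
  arrow⇒FC {i} {k} (w , w∈ , w~) r = subst (Allowed 𝓑 (inj₂ i)) (vertex-≡ _ (σ∈ k) eq) (project-allowed N i) ◅ σ-to-K k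
    where
    e : σ k ~ w
    e = ~-sym w~
    N : PM Whole
    N = complete-by-edge e (reach⇒PM r w∈)
    mw : mate N w ≡ σ k
    mw = mate-swap N tt (complete-by-edge-mate e (reach⇒PM r w∈))
    eq : Exits.σ N i ≡ σ k
    eq = trans (cong (mate N) (≡-sym (Exits.exit-unique N w∈ (subst (_∈ X) (≡-sym mw) (σ∈ k))))) mw

  abstract
    sc⇒FC : ∀ {i k} → SC i k → FC 𝓑 (inj₂ i) (inj₂ k)
    sc⇒FC (there-path , back-path) = follow there-path back-path
      where
      follow : ∀ {i k} → Reach i k → Reach k i → FC 𝓑 (inj₂ i) (inj₂ k)
      follow ε _ = ε
      follow (a ◅ s) r = arrow⇒FC a (s ◅◅ r) ◅◅ follow s (r ◅◅ (a ◅ ε))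

  idx-FC : ∀ v → FC 𝓑 v (inj₂ (idx v))
  idx-FC (inj₁ (x , x∈)) = subst (λ v → FC 𝓑 v (inj₂ (idx (inj₁ (x , x∈))))) (idx-σ x∈) (σ-to-K (idx (inj₁ (x , x∈))))
  idx-FC (inj₂ j) = ε

  module _ (d : V 𝓑) where

    -- The expansion in terms of the digraph, where membership is decidable by reachability.
    Inside : Fin n → Set
    Inside v = Σ (Fin l) λ j → SC (idx d) j × (v ∈ K j ⊎ v ≡ σ j)

    inside? : ∀ v → Dec (Inside v)
    inside? v = any? λ j → sc? (idx d) j ×-dec ((v ∈? K j) ⊎-dec (v ≟ σ j))

    expansion⇒inside : ∀ {v} → Expansion G X Ks d v → Inside v
    expansion⇒inside (inj₁ (v∈ , fc)) = idx (inj₁ (_ , v∈)) , FC⇒sc fc , inj₂ (≡-sym (proj₂ (σ-surjective v∈)))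
    expansion⇒inside (inj₂ (j , fc , v∈)) = j , FC⇒sc fc , inj₁ v∈

    inside⇒expansion : ∀ {v} → Inside v → Expansion G X Ks d v
    inside⇒expansion (j , sc , inj₁ v∈) = inj₂ (j , idx-FC d ◅◅ sc⇒FC sc , v∈)
    inside⇒expansion (j , sc , inj₂ refl) = inj₁ (σ∈ j , idx-FC d ◅◅ sc⇒FC sc ◅◅ FC-sym (σ-to-K j))

-- The cathedral structure

module Contraction {n : ℕ} (G : Graph n) (Y : Subset n) (r : Fin n) where
  open Factors G

  𝒞 : Gr
  𝒞 = Contract (Induce ⟦ G ⟧ (_∈ Y)) (λ w → FCG G r (proj₁ w))

  𝒞-sym : ∀ {a b} → E 𝒞 a b → E 𝒞 b a
  𝒞-sym {inj₁ _} {inj₁ _} e = ~-sym e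
  𝒞-sym {inj₁ _} {inj₂ _} (w , w∈ , e) = w , w∈ , ~-sym e
  𝒞-sym {inj₂ _} {inj₁ _} (w , w∈ , e) = w , w∈ , ~-sym e

  𝒞-irrefl : ∀ {a} → ¬ E 𝒞 a a
  𝒞-irrefl {inj₁ _} e = ~-irrefl e refl
  𝒞-irrefl {inj₂ _} ()

  𝒞-finite : Finite (V 𝒞)
  𝒞-finite = finite-⊎ (finite-Σ (finite-Σ (finite-Fin n) (_∈? Y) ∈-irrelevant) (λ w → ¬? (FCG? r (proj₁ w))) (λ _ _ → refl)) finite-⊤

  module _ (z₀ : V 𝒞) where

    Rest : Gr
    Rest = Induce 𝒞 (_≢ z₀)

    rest-factorizable : Pairing Rest → Factorizable Rest
    rest-factorizable F = proj₁ (fromPairing {𝒢 = Rest}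
      (finite-Σ 𝒞-finite (λ z → ¬? (Finite.decEq 𝒞-finite z z₀)) (λ _ _ → refl)) (λ {z} → 𝒞-irrefl {proj₁ z}) F)

  Outer : Fin n → Set
  Outer v = v ∈ Y × ¬ FCG G r v

  outer-vertex : ∀ {v} → Outer v → V 𝒞
  outer-vertex (v∈ , v∉) = inj₁ ((_ , v∈) , v∉)

  outer-vertex-≡ : ∀ {u v} (p : Outer u) (q : Outer v) → u ≡ v → outer-vertex p ≡ outer-vertex q
  outer-vertex-≡ (u∈ , _) (v∈ , _) refl with ∈-irrelevant u∈ v∈
  ... | refl = refl

  contract-minus-centre : PM Outer → Factorizable (Rest (inj₂ tt))
  contract-minus-centre N = rest-factorizable (inj₂ tt) record
    { partner = f
    ; partner² = λ { (inj₁ ((v , v∈) , v∉) , z≢) → rest-≡ (outer-vertex-≡ (mate∈ N (mate∈ N (v∈ , v∉))) (v∈ , v∉) (mate² N (v∈ , v∉)))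
                   ; (inj₂ tt , z≢) → contradiction refl z≢ }
    ; v~partner = λ { (inj₁ ((v , v∈) , v∉) , z≢) → v~mate N (v∈ , v∉) ; (inj₂ tt , z≢) → contradiction refl z≢ } }
    where
    rest-≡ : ∀ {a b} {p : a ≢ inj₂ tt} {q : b ≢ inj₂ tt} → a ≡ b → _≡_ {A = V (Rest (inj₂ tt))} (a , p) (b , q)
    rest-≡ refl = refl
    f : V (Rest (inj₂ tt)) → V (Rest (inj₂ tt))
    f (inj₁ ((v , v∈) , v∉) , _) = outer-vertex (mate∈ N (v∈ , v∉)) , λ ()
    f (inj₂ tt , z≢) = contradiction refl z≢

  module _ {x} (ox : Outer x) where

    private
      R : Gr
      R = Rest (outer-vertex ox)

      centre : V R
      centre = inj₂ tt , λ ()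

    -- The centre of the contraction corresponds to h.
    Near : Fin n → Fin n → Set
    Near h v = (Outer v × v ≢ x) ⊎ v ≡ h

    private
      module Points {h} (h∈H : FCG G r h) where

        point : V R → Fin n
        point (inj₁ ((v , _) , _) , _) = v
        point (inj₂ _ , _) = h

        point-near : ∀ z → Near h (point z)
        point-near (inj₁ ((v , v∈) , v∉) , z≢) = inj₁ ((v∈ , v∉) , λ v≡x → z≢ (outer-vertex-≡ (v∈ , v∉) ox v≡x))
        point-near (inj₂ _ , _) = inj₂ refl

        embed : ∀ v → Near h v → V R
        embed v (inj₁ (ov , v≢x)) = outer-vertex ov , λ eq → v≢x (outer-injective eq)
          where
          outer-injective : ∀ {u v} {p : Outer u} {q : Outer v} → outer-vertex p ≡ outer-vertex q → u ≡ v
          outer-injective refl = refl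
        embed v (inj₂ _) = centre

        point-embed : ∀ v (p : Near h v) → point (embed v p) ≡ v
        point-embed v (inj₁ _) = refl
        point-embed v (inj₂ v≡h) = ≡-sym v≡h

        rest-≡ : ∀ {a b : V R} → proj₁ a ≡ proj₁ b → a ≡ b
        rest-≡ {a , p} {_ , q} refl = cong {A = a ≢ outer-vertex ox} (λ s → _,_ {B = _≢ outer-vertex ox} a s) refl

        point-injective : ∀ a b → point a ≡ point b → a ≡ b
        point-injective (inj₁ ((u , u∈) , u∉) , _) (inj₁ ((v , v∈) , v∉) , _) eq = rest-≡ (outer-vertex-≡ (u∈ , u∉) (v∈ , v∉) eq)
        point-injective (inj₁ ((u , u∈) , u∉) , _) (inj₂ _ , _) refl = contradiction h∈H u∉
        point-injective (inj₂ _ , _) (inj₁ ((v , v∈) , v∉) , _) refl = contradiction h∈H v∉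
        point-injective (inj₂ _ , _) (inj₂ _ , _) _ = rest-≡ refl

    contract-minus-outer : ∀ {h} → h ∈ Y → FCG G r h → PM (Near h) → Factorizable R
    contract-minus-outer {h} h∈Y h∈H N = rest-factorizable (outer-vertex ox) record
      { partner = f ; partner² = f² ; v~partner = λ z → edge z _ (mate∈ N (point-near z)) (v~mate N (point-near z)) }
      where
      open Points h∈H
      f : V R → V R
      f z = embed (mate N (point z)) (mate∈ N (point-near z))
      f² : ∀ z → f (f z) ≡ z
      f² z = point-injective (f (f z)) z (trans (point-embed _ (mate∈ N (point-near (f z))))
        (trans (cong (mate N) (point-embed _ (mate∈ N (point-near z)))) (mate² N (point-near z))))
      edge : ∀ z v (p : Near h v) → point z ~ v → E R z (embed v p)
      edge (inj₁ _ , _) v (inj₁ _) e = e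
      edge (inj₁ _ , _) v (inj₂ refl) e = (h , h∈Y) , h∈H , e
      edge (inj₂ _ , _) v (inj₁ _) e = (h , h∈Y) , h∈H , e
      edge (inj₂ _ , _) v (inj₂ refl) e = contradiction refl (~-irrefl e)

    -- The matching joins the centre to some outer vertex; `h` is an end, in the contracted
    -- factor-component, of an edge of `G` that this edge comes from.
    matching-of-contraction : Factorizable R → Σ (Fin n) λ h → FCG G r h × PM (Near h)
    matching-of-contraction L = h , h∈H , record
      { mate = m ; mate∈ = λ p → subst (Near h) (≡-sym (m-eq p)) (point-near (partner F (embed _ p))) ; mate² = m²
      ; v~mate = λ {v} p → subst (v ~_) (≡-sym (m-eq p)) (subst (_~ point (partner F (embed v p))) (point-embed v p)
                   (edge (embed v p) (partner F (embed v p)) (v~partner F (embed v p)) refl)) }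
      where
      F : Pairing R
      F = proj₁ (toPairing (λ {a} {b} → 𝒞-sym {proj₁ a} {proj₁ b}) L)
      attach : ∀ z → E R centre z → Σ (Fin n) λ h → FCG G r h × (∀ {u u∈ u∉} → proj₁ z ≡ inj₁ ((u , u∈) , u∉) → h ~ u)
      attach (inj₁ _ , _) ((h , _) , h∈H , e) = h , h∈H , λ { refl → e }
      h : Fin n
      h = proj₁ (attach (partner F centre) (v~partner F centre))
      h∈H : FCG G r h
      h∈H = proj₁ (proj₂ (attach (partner F centre) (v~partner F centre)))
      h~ : ∀ {u u∈ u∉} → proj₁ (partner F centre) ≡ inj₁ ((u , u∈) , u∉) → h ~ u
      h~ = proj₂ (proj₂ (attach (partner F centre) (v~partner F centre)))
      open Points h∈H
      edge : ∀ a b → E R a b → partner F a ≡ b → point a ~ point b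
      edge (inj₁ _ , _) (inj₁ _ , _) e _ = e
      edge a@(inj₁ _ , _) b@(inj₂ _ , _) _ eq =
        ~-sym (h~ (cong proj₁ (trans (cong (partner F) (point-injective centre b refl)) (trans (cong (partner F) (≡-sym eq)) (partner² F a)))))
      edge a@(inj₂ _ , _) (inj₁ _ , _) _ eq = h~ (cong proj₁ (trans (cong (partner F) (point-injective centre a refl)) eq))
      near? : ∀ v → Dec (Near h v)
      near? v = (((v ∈? Y) ×-dec ¬? (FCG? r v)) ×-dec ¬? (v ≟ x)) ⊎-dec (v ≟ h)
      m : Fin n → Fin n
      m v with near? v
      ... | yes p = point (partner F (embed v p))
      ... | no _ = v
      embed-≡ : ∀ {v} (p q : Near h v) → embed v p ≡ embed v q
      embed-≡ p q = point-injective _ _ (trans (point-embed _ p) (≡-sym (point-embed _ q)))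
      m-eq : ∀ {v} (p : Near h v) → m v ≡ point (partner F (embed v p))
      m-eq {v} p with near? v
      ... | yes q = cong (λ z → point (partner F z)) (embed-≡ q p)
      ... | no ¬p = contradiction p ¬p
      m² : ∀ {v} → Near h v → m (m v) ≡ v
      m² {v} p = trans (cong m (m-eq p)) (trans (m-eq (point-near z))
        (trans (cong (point ∘ partner F) (point-injective (embed (point z) (point-near z)) z (point-embed _ (point-near z))))
          (trans (cong point (partner² F (embed v p))) (point-embed v p))))
        where
        z : V R
        z = partner F (embed v p)

module Cathedral {n : ℕ} (G : Graph n) (M₀ : Factorizable ⟦ G ⟧)
                 (X : Subset n) (X-odd-maximal : OddMaximal G X)
                 (Ks : List (Subset n)) (Ks-odd : OddComps G X Ks) (d : Gr.V (GX G X Ks)) where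
  open Reduction G M₀ X X-odd-maximal Ks Ks-odd

  j₀ : Fin l
  j₀ = idx d

  r : Fin n
  r = σ j₀

  In : Fin n → Set
  In = Inside d

  in? : ∀ v → Dec (In v)
  in? = inside? d

  -- M shows that the set of vertices of K i in the factor-component of exitOf i is odd; were w not
  -- in it, N would match it internally.
  same-factor-component : ∀ (N : PM Whole) {i w} → w ∈ K i → mate N w ∈ X → FCG G (exitOf i) w
  same-factor-component N {i} {w} w∈ mw∈ with FCG? (exitOf i) w
  ... | yes p = p
  ... | no ¬p = contradiction (PM-size-even Z-PM) (λ even-Z → even-not-suc ∣ Z - e ∣ (PM-size-even Z-e-PM)
                  (trans (cong (_% 2) (suc∣p-x∣≡∣p∣ (∈⟪⟫⁺ Z? (exitOf∈ i , ε)))) even-Z))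
    where
    module N = Exits N
    e : Fin n
    e = exitOf i
    Z? : ∀ v → Dec (v ∈ K i × FCG G e v)
    Z? v = (v ∈? K i) ×-dec FCG? e v
    Z : Subset n
    Z = ⟪ Z? ⟫
    Z-PM : PM (_∈ Z)
    Z-PM = restrict N (λ _ → tt) λ v∈ → let v∈K , ev = ∈⟪⟫⁻ Z? v∈ in
      ∈⟪⟫⁺ Z? (N.stays v∈K (λ v≡ → ¬p (subst (FCG G e) (trans v≡ (≡-sym (N.exit-unique w∈ mw∈))) ev)) , FCG-mate N ev)
    Z-e-PM : PM (_∈ Z - e)
    Z-e-PM = restrict M (λ _ → tt) λ {v} v∈ → let v∈K , ev = ∈⟪⟫⁻ Z? (x∈p-y⇒x∈p v∈) in
      x∈p∧x≢y⇒x∈p-y (∈⟪⟫⁺ Z? (stays v∈K (x∈p-y⇒x≢y v∈) , FCG-mate M ev))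
        (λ mv≡e → K∩X v∈K (subst (_∈ X) (mate-swap M tt mv≡e) (σ∈ i)))

  σ-exit : ∀ j → FCG G (σ j) (exitOf j)
  σ-exit j = subst (FCG G (σ j)) (mate-σ j) (FCG-mate M ε)

  -- `M` links `σ i` to `exitOf i`, and a rerouted matching links `w` to `σ k`. Between `exitOf i`
  -- and `w` no allowed edge is at hand, so the parity argument has to connect them.
  arrow⇒FCG : ∀ {i k} → Arrow i k → Reach k i → FCG G (σ i) (σ k)
  arrow⇒FCG {i} {k} (w , w∈ , w~) p = σ-exit i ◅◅ same-factor-component N w∈ (subst (_∈ X) (≡-sym mw) (σ∈ k)) ◅◅
      (allowed-sym (crossing-allowed p w∈ w~) ◅ ε)
    where
    N : PM Whole
    N = complete-by-edge (~-sym w~) (reach⇒PM p w∈)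
    mw : mate N w ≡ σ k
    mw = mate-swap N tt (complete-by-edge-mate (~-sym w~) (reach⇒PM p w∈))

  sc⇒FCG : ∀ {k} → SC j₀ k → FCG G r (σ k)
  sc⇒FCG (there-path , back-path) = follow there-path back-path
    where
    follow : ∀ {i k} → Reach i k → Reach k i → FCG G (σ i) (σ k)
    follow ε _ = ε
    follow (a ◅ s) p = arrow⇒FCG a (s ◅◅ p) ◅◅ follow s (p ◅◅ (a ◅ ε))

  exit-FCG : ∀ {k} → SC j₀ k → FCG G r (exitOf k)
  exit-FCG {k} sc = sc⇒FCG sc ◅◅ σ-exit k

  in∧X⇒FCG : ∀ {v} → In v → v ∈ X → FCG G r v
  in∧X⇒FCG (j , sc , inj₁ v∈K) v∈X = contradiction v∈X (K∩X v∈K)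
  in∧X⇒FCG (j , sc , inj₂ refl) _ = sc⇒FCG sc

  in-mate : ∀ {u} (N : PM Whole) → In u → In (mate N u)
  in-mate {u} N (j , sc , inj₁ u∈) = by-cases (mate N u ∈? X)
    where
    by-cases : Dec (mate N u ∈ X) → In (mate N u)
    by-cases (no m∉) = j , sc , inj₁ (K-closed u∈ m∉ (v~mate N tt))
    by-cases (yes m∈) = k , sc-trans sc ((proj₁ crossing ◅ ε) , proj₂ crossing) , inj₂ (≡-sym eq)
      where
      k : Fin l
      k = proj₁ (σ-surjective m∈)
      eq : σ k ≡ mate N u
      eq = proj₂ (σ-surjective m∈)
      crossing : Arrow j k × Reach k j
      crossing = crossing-edge N u∈ (≡-sym eq)
  in-mate {u} N (j , sc , inj₂ u≡σ) = i , sc-trans sc (proj₂ crossing , (proj₁ crossing ◅ ε)) ,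
      inj₁ (subst (_∈ K i) (trans (≡-sym (N.mate-σ i)) (cong (mate N) (trans eq (≡-sym u≡σ)))) (N.exitOf∈ i))
    where
    module N = Exits N
    i : Fin l
    i = proj₁ (N.σ-surjective (σ∈ j))
    eq : N.σ i ≡ σ j
    eq = proj₂ (N.σ-surjective (σ∈ j))
    crossing : Arrow i j × Reach j i
    crossing = crossing-edge N (N.exitOf∈ i) eq

  in-allowed : ∀ {u v} → In u → Allowed ⟦ G ⟧ u v → In v
  in-allowed iu a = subst In (proj₂ (allowed⇒PM a)) (in-mate (proj₁ (allowed⇒PM a)) iu)

  in-FCG : ∀ {u v} → In u → FCG G u v → In v
  in-FCG iu ε = iu
  in-FCG iu (a ◅ s) = in-FCG (in-allowed iu a) s

  r-in : In r
  r-in = j₀ , sc-refl , inj₂ refl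

  FCG⇒in : ∀ {v} → FCG G r v → In v
  FCG⇒in = in-FCG r-in

  S : Fin n → Set
  S w = w ∈ X × Expansion G X Ks d w

  class-in-P : InP G r S
  class-in-P = (r , λ v → mk⇔ to from) , λ v (v∈ , ex) → in∧X⇒FCG (expansion⇒inside d ex) v∈
    where
    minus? : ∀ u v w → Dec (w ≢ u × w ≢ v)
    minus? u v w = ¬? (w ≟ u) ×-dec ¬? (w ≟ v)
    to : ∀ {v} → S v → Sim G r v
    to {v} (v∈ , ex) = in∧X⇒FCG (expansion⇒inside d ex) v∈ , λ L →
      -- All `l` odd components survive the deletion of `r` and `v`, but only `X - r` could receive
      -- their exits. Discounting `r` alone also covers the case `v = r`.
      <⇒≱ (x∈p⇒∣p-x∣<∣p∣ (σ∈ j₀)) (≤-trans (≤-reflexive (≡-sym l≡∣X∣))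
        (odd-components-bound {Z = X} {Z′ = X - r} (factorizable⇒PM-induced (minus? r v) (λ _ _ → refl) L) Ks Ks-unique
          (λ C∈ → Ks⇒odd C∈ , λ w∈C → let w∉X = proj₁ (proj₁ (Ks⇒odd C∈)) _ w∈C in
            (λ { refl → w∉X (σ∈ j₀) }) , λ { refl → w∉X v∈ })
          (λ w∈ (w≢r , _) → x∈p∧x≢y⇒x∈p-y w∈ w≢r)))
    from : ∀ {v} → Sim G r v → S v
    from (rv , ¬L) with FCG⇒in rv
    ... | iv@(j , sc , inj₂ refl) = σ∈ j , inside⇒expansion d iv
    ... | (j , sc , inj₁ v∈K) = contradiction
            (PM⇒factorizable (minus? _ _) (λ _ _ → refl) (reach⇒PM (proj₁ sc) v∈K)) ¬L

  module _ {v} (iv : In v) where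
    private
      Y : Subset n
      Y = ⟪ in? ⟫

      open Contraction G Y r

      outer-M : ∀ {w} → Outer w → Outer (mate M w)
      outer-M (w∈ , w∉) = ∈⟪⟫⁺ in? (in-FCG (∈⟪⟫⁻ in? w∈) (FCG-mate M ε)) ,
                          λ p → w∉ (subst (FCG G r) (mate² M tt) (FCG-mate M p))

      separating : Separating G Y
      separating u with in? u
      ... | yes iu = inj₁ λ w p → ∈⟪⟫⁺ in? (in-FCG iu p)
      ... | no ¬iu = inj₂ λ w p w∈ → ¬iu (in-FCG (∈⟪⟫⁻ in? w∈) (FCG-sym p))

      module Extend {x} (ox : Outer x) {j} (sc : SC j₀ j) (x∈K : x ∈ K j) where

        A? : ∀ w → Dec (w ∈ K j × ¬ FCG G r w)
        A? w = (w ∈? K j) ×-dec ¬? (FCG? r w)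

        B? : ∀ w → Dec (w ∈ K j × w ≢ x)
        B? w = (w ∈? K j) ×-dec ¬? (w ≟ x)

        A-PM : PM (_∈ ⟪ A? ⟫)
        A-PM = restrict M (λ _ → tt) λ w∈ → let w∈K , w∉ = ∈⟪⟫⁻ A? w∈ in
          ∈⟪⟫⁺ A? (stays w∈K (λ { refl → w∉ (exit-FCG sc) }) , λ p → w∉ (subst (FCG G r) (mate² M tt) (FCG-mate M p)))

        B-PM : PM (_∈ ⟪ B? ⟫)
        B-PM = respects (∈⟪⟫⁺ B?) (∈⟪⟫⁻ B?) (K-factor-critical j x∈K)

        away-PM : PM (λ w → Outer w × w ∉ K j)
        away-PM = restrict M (λ _ → tt) λ (ow@(w∈ , w∉) , w∉K) → outer-M ow ,
          λ mw∈ → w∉K (K-closed mw∈ (λ w∈X → w∉ (in∧X⇒FCG (∈⟪⟫⁻ in? w∈) w∈X)) (~-sym (v~mate M tt)))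

        module _ {h} (rh : FCG G r h) (N : PM (λ w → (w ∈ ⟪ A? ⟫ × w ≢ x) ⊎ w ≡ h)) where

          extension : PM (Near ox h)
          extension = union (λ w → ((w ∈? ⟪ A? ⟫) ×-dec ¬? (w ≟ x)) ⊎-dec (w ≟ h)) N away-PM disjoint split within
              (λ (ow , w∉K) → inj₁ (ow , λ { refl → w∉K x∈K }))
            where
            disjoint : ∀ {w} → (w ∈ ⟪ A? ⟫ × w ≢ x) ⊎ w ≡ h → ¬ (Outer w × w ∉ K j)
            disjoint (inj₁ (w∈A , _)) (_ , w∉K) = w∉K (proj₁ (∈⟪⟫⁻ A? w∈A))
            disjoint (inj₂ refl) ((_ , ¬rh) , _) = ¬rh rh
            split : ∀ {w} → Near ox h w → ((w ∈ ⟪ A? ⟫ × w ≢ x) ⊎ w ≡ h) ⊎ (Outer w × w ∉ K j)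
            split (inj₂ w≡h) = inj₁ (inj₂ w≡h)
            split {w} (inj₁ (ow , w≢x)) with w ∈? K j
            ... | yes w∈K = inj₁ (inj₁ (∈⟪⟫⁺ A? (w∈K , proj₂ ow) , w≢x))
            ... | no w∉K = inj₂ (ow , w∉K)
            within : ∀ {w} → (w ∈ ⟪ A? ⟫ × w ≢ x) ⊎ w ≡ h → Near ox h w
            within (inj₂ w≡h) = inj₂ w≡h
            within (inj₁ (w∈A , w≢x)) with ∈⟪⟫⁻ A? w∈A
            ... | w∈K , w∉ = inj₁ ((∈⟪⟫⁺ in? (j , sc , inj₁ w∈K) , w∉) , w≢x)

        -- `M` matches `K j` without `H`, because `exitOf j` lies in `H`; factor-criticality matches
        -- `K j - x`. The first set exceeds the second only in `x`, and the second exceeds the first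
        -- only in vertices of `H`. Hence the path from `x` ends in `H`, and switching `M` along it
        -- uncovers `x` and covers one vertex `h` of `H`.
        near-matching : Σ (Fin n) λ h → h ∈ Y × FCG G r h × PM (Near ox h)
        near-matching with alternating-path A-PM B-PM (∈⟪⟫⁺ A? (x∈K , proj₂ ox)) (λ x∈B → proj₂ (∈⟪⟫⁻ B? x∈B) refl)
        ... | inj₂ (h , h∈A , h∉B , h≢x , _) = contradiction (∈⟪⟫⁺ B? (proj₁ (∈⟪⟫⁻ A? h∈A) , h≢x)) h∉B
        ... | inj₁ (h , h∈B , h∉A , N) with FCG? r h
        ...   | no ¬rh = contradiction (∈⟪⟫⁺ A? (proj₁ (∈⟪⟫⁻ B? h∈B) , ¬rh)) h∉A
        ...   | yes rh = h , ∈⟪⟫⁺ in? (FCG⇒in rh) , rh , extension rh N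

      near-matching : ∀ {x} (ox : Outer x) → In x → Σ (Fin n) λ h → h ∈ Y × FCG G r h × PM (Near ox h)
      near-matching ox (j , sc , inj₂ refl) = contradiction (sc⇒FCG sc) (proj₂ ox)
      near-matching ox (j , sc , inj₁ x∈K) = Extend.near-matching ox sc x∈K

      factor-critical : FactorCritical 𝒞
      factor-critical (inj₂ tt) = inj₂ (contract-minus-centre (restrict M (λ _ → tt) outer-M))
      factor-critical (inj₁ ((x , x∈) , x∉)) = from-matching (near-matching (x∈ , x∉) (∈⟪⟫⁻ in? x∈))
        where
        from-matching : Σ (Fin n) (λ h → h ∈ Y × FCG G r h × PM (Near (x∈ , x∉) h)) →
                        (∀ z → z ≡ outer-vertex (x∈ , x∉)) ⊎ Factorizable (Rest (outer-vertex (x∈ , x∉)))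
        from-matching (h , h∈ , rh , N) = inj₂ (contract-minus-outer (x∈ , x∉) h∈ rh N)

    in⇒⊴ : _⊴_ G r v
    in⇒⊴ = Y , separating , (λ w p → ∈⟪⟫⁺ in? (FCG⇒in p)) , (λ w p → ∈⟪⟫⁺ in? (in-FCG iv p)) , factor-critical

  in⇒UStar : ∀ {v} → In v → UStar G r v
  in⇒UStar {v} iv = v , in⇒⊴ iv , ε

  compU-end : ∀ {a b} → UH G r a → CompU G r a b → UH G r b
  compU-end ua ε = ua
  compU-end _ ((_ , ub , _) ◅ s) = compU-end ub s

  -- A walk inside K j from v to exitOf j enters the factor-component of r at a vertex of K j,
  -- hence not in S.
  in⇒¬USet : ∀ {v} → In v → ¬ USet G r S v
  in⇒¬USet {v} iv (s , _ , ¬rs , (k , uk , Γ⊆S , s⊆) , sv) = by-cases iv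
    where
    ¬rv : ¬ FCG G r v
    ¬rv rv = ¬rs (rv ◅◅ FCG-sym sv)
    by-cases : In v → ⊥
    by-cases (j , sc , inj₂ refl) = ¬rv (sc⇒FCG sc)
    by-cases (j , sc , inj₁ v∈K) = walk (s⊆ v sv) (K-connected v∈K (exitOf∈ j))
      where
      walk : ∀ {a} → CompU G r k a → Star (λ a b → a ∈ K j × b ∈ K j × a ~ b) a (exitOf j) → ⊥
      walk ka ε = proj₂ (compU-end uk ka) (exit-FCG sc)
      walk {a} ka (_◅_ {j = b} (_ , b∈ , a~b) rest) = advance (FCG? r b)
        where
        advance : Dec (FCG G r b) → ⊥
        advance (yes rb) = K∩X b∈ (proj₁ (Γ⊆S b (λ kb → proj₂ (compU-end uk kb) rb) (a , ka , a~b) rb))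
        advance (no ¬rb) = walk (ka ◅◅ ((compU-end uk ka , (in⇒UStar (j , sc , inj₁ b∈) , ¬rb) , a~b) ◅ ε)) rest

  -- The alternating path from σ k to the factor-component of r given by the factor-critical
  -- contraction follows arrows only, since it enters every K i at the vertex that M matches outside.
  module _ {k} {h} (k-unreaching : ∀ {i} → Reach k i → h ∈ K i ⊎ h ≡ σ i → ⊥) where

    trapped : ∀ m A {w i} → ∣ A ∣ ≤ m → (∀ {v} → v ∈ A → mate M v ∈ A) → h ∉ A → w ∈ A →
              PM (λ v → (v ∈ A × v ≢ w) ⊎ v ≡ h) → Reach k i → w ≡ σ i ⊎ (w ∈ K i × exitOf i ∉ A) → ⊥
    trapped zero A A≤0 _ _ w∈ _ _ _ = contradiction (≤-trans (≤-trans (s≤s z≤n) (x∈p⇒∣p-x∣<∣p∣ w∈)) A≤0) λ ()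
    trapped (suc m) A {w} {i} A≤ closed h∉ w∈ N ki pos with mate∈ N x-near
      where
      x-near : (mate M w ∈ A × mate M w ≢ w) ⊎ mate M w ≡ h
      x-near = inj₁ (closed w∈ , mate≢ M tt)
    ... | y-near = continue y-near
      where
      x y : Fin n
      x = mate M w
      y = mate N x
      x-near : (x ∈ A × x ≢ w) ⊎ x ≡ h
      x-near = inj₁ (closed w∈ , mate≢ M tt)
      A′? : ∀ v → Dec (v ∈ A × v ≢ w × v ≢ x)
      A′? v = (v ∈? A) ×-dec (¬? (v ≟ w) ×-dec ¬? (v ≟ x))
      A′ : Subset n
      A′ = ⟪ A′? ⟫
      -- From `σ i` the `M`-edge enters `K i` at `exitOf i` and uses that vertex up. While the path
      -- remains in `K i`, its `M`-edges therefore cannot leave `K i`.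
      x-pos : x ∈ K i × exitOf i ∉ A′
      x-pos = from pos
        where
        from : w ≡ σ i ⊎ (w ∈ K i × exitOf i ∉ A) → x ∈ K i × exitOf i ∉ A′
        from (inj₁ refl) = subst (_∈ K i) (≡-sym (mate-σ i)) (exitOf∈ i) ,
                           λ e∈ → proj₂ (proj₂ (∈⟪⟫⁻ A′? e∈)) (≡-sym (mate-σ i))
        from (inj₂ (w∈K , e∉)) = stays w∈K (λ { refl → e∉ w∈ }) , e∉ ∘ proj₁ ∘ ∈⟪⟫⁻ A′?
      -- An edge of `N` leaving `K i` ends in `X`, at some `σ i′`, and is itself an arrow from `i`
      -- to `i′`.
      y-pos : Σ (Fin l) λ i′ → Reach k i′ × (y ≡ σ i′ ⊎ (y ∈ K i′ × exitOf i′ ∉ A′))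
      y-pos with y ∈? X
      ... | no y∉ = i , ki , inj₂ (K-closed (proj₁ x-pos) y∉ (v~mate N x-near) , proj₂ x-pos)
      ... | yes y∈ with σ-surjective y∈
      ...   | i′ , eq = i′ , ki ◅◅ ((x , proj₁ x-pos , subst (x ~_) (≡-sym eq) (v~mate N x-near)) ◅ ε) , inj₁ (≡-sym eq)
      continue : (y ∈ A × y ≢ w) ⊎ y ≡ h → ⊥
      continue (inj₂ y≡h) with y-pos
      ... | i′ , ki′ , inj₁ y≡σ = k-unreaching ki′ (inj₂ (trans (≡-sym y≡h) y≡σ))
      ... | i′ , ki′ , inj₂ (y∈K , _) = k-unreaching ki′ (inj₁ (subst (_∈ K i′) y≡h y∈K))
      continue (inj₁ (y∈A , y≢w)) = trapped m A′
          (≤-pred (≤-trans (∣p∣<∣q∣ (proj₁ ∘ ∈⟪⟫⁻ A′?) w∈ λ w∈′ → proj₁ (proj₂ (∈⟪⟫⁻ A′? w∈′)) refl) A≤))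
          closed′ (h∉ ∘ proj₁ ∘ ∈⟪⟫⁻ A′?) (∈⟪⟫⁺ A′? (y∈A , y≢w , mate≢ N x-near))
          (respects shrink shrink⁻ (delete-edge N x-near)) (proj₁ (proj₂ y-pos)) (proj₂ (proj₂ y-pos))
        where
        closed′ : ∀ {v} → v ∈ A′ → mate M v ∈ A′
        closed′ v∈ with ∈⟪⟫⁻ A′? v∈
        ... | v∈A , v≢w , v≢x = ∈⟪⟫⁺ A′? (closed v∈A , (λ mv≡w → v≢x (≡-sym (mate-swap M tt mv≡w))) ,
                λ mv≡mw → v≢w (trans (≡-sym (mate² M tt)) (trans (cong (mate M) mv≡mw) (mate² M tt))))
        shrink : ∀ {v} → ((v ∈ A × v ≢ w) ⊎ v ≡ h) × v ≢ x × v ≢ y → (v ∈ A′ × v ≢ y) ⊎ v ≡ h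
        shrink (inj₁ (v∈ , v≢w) , v≢x , v≢y) = inj₁ (∈⟪⟫⁺ A′? (v∈ , v≢w , v≢x) , v≢y)
        shrink (inj₂ v≡h , _) = inj₂ v≡h
        shrink⁻ : ∀ {v} → (v ∈ A′ × v ≢ y) ⊎ v ≡ h → ((v ∈ A × v ≢ w) ⊎ v ≡ h) × v ≢ x × v ≢ y
        shrink⁻ (inj₁ (v∈ , v≢y)) = let v∈A , v≢w , v≢x = ∈⟪⟫⁻ A′? v∈ in inj₁ (v∈A , v≢w) , v≢x , v≢y
        shrink⁻ (inj₂ refl) = inj₂ refl , (λ h≡x → h∉ (subst (_∈ A) (≡-sym h≡x) (closed w∈))) , λ h≡y → h∉ (subst (_∈ A) (≡-sym h≡y) y∈A)

  no-arrow-to-outside : ∀ {j k s} → SC j₀ j → Arrow j k → ¬ In (σ k) → _⊴_ G r s → ¬ FCG G s (σ k)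
  no-arrow-to-outside {j} {k} scj arrow ¬ik (Y , sep , _ , s⊆Y , fc) sσ = by-cases (fc (outer-vertex ox))
    where
    open Contraction G Y r
    ox : Outer (σ k)
    ox = s⊆Y _ sσ , ¬ik ∘ FCG⇒in
    ¬sc : ¬ SC j₀ k
    ¬sc sc = ¬ik (k , sc , inj₂ refl)
    A? : ∀ v → Dec (Outer v)
    A? v = (v ∈? Y) ×-dec ¬? (FCG? r v)
    A : Subset n
    A = ⟪ A? ⟫
    outer-closed : ∀ {v} → Outer v → Outer (mate M v)
    outer-closed {v} (v∈Y , v∉) = [ (λ ⊆Y → ⊆Y _ (FCG-mate M ε)) , (λ ∩Y → contradiction v∈Y (∩Y v ε)) ]′ (sep v) ,
                                  λ p → v∉ (subst (FCG G r) (mate² M tt) (FCG-mate M p))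
    module _ {h} (rh : FCG G r h) where
      same : ∀ {i i′} → h ∈ K i ⊎ h ≡ σ i → h ∈ K i′ ⊎ h ≡ σ i′ → i ≡ i′
      same (inj₁ p) (inj₁ q) = K-disjoint p q
      same (inj₁ p) (inj₂ q) = contradiction (subst (_∈ X) (≡-sym q) (σ∈ _)) (K∩X p)
      same (inj₂ p) (inj₁ q) = contradiction (subst (_∈ X) (≡-sym p) (σ∈ _)) (K∩X q)
      same (inj₂ p) (inj₂ q) = σ-injective (trans (≡-sym p) q)
      -- As `h` lies in the expansion, reaching its index from `k` would close a cycle with the
      -- arrow from `j` to `k` and put `k` in the strong component of `j₀`.
      unreaching′ : ∀ {i} → In h → Reach k i → h ∈ K i ⊎ h ≡ σ i → ⊥
      unreaching′ {i} (i′ , sc , q) ki p = ¬sc (proj₁ scj ◅◅ (arrow ◅ ε) , subst (Reach k) (same p q) ki ◅◅ proj₂ sc)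
      unreaching : ∀ {i} → Reach k i → h ∈ K i ⊎ h ≡ σ i → ⊥
      unreaching = unreaching′ (FCG⇒in rh)
      to-A : ∀ {v} → Near ox h v → (v ∈ A × v ≢ σ k) ⊎ v ≡ h
      to-A (inj₁ (ov , v≢)) = inj₁ (∈⟪⟫⁺ A? ov , v≢)
      to-A (inj₂ e) = inj₂ e
      from-A : ∀ {v} → (v ∈ A × v ≢ σ k) ⊎ v ≡ h → Near ox h v
      from-A (inj₁ (v∈ , v≢)) = inj₁ (∈⟪⟫⁻ A? v∈ , v≢)
      from-A (inj₂ e) = inj₂ e
    by-cases : (∀ z → z ≡ outer-vertex ox) ⊎ Factorizable (Rest (outer-vertex ox)) → ⊥
    by-cases (inj₁ single) = centre≢outer (single (inj₂ tt))
      where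
      centre≢outer : ∀ {a b} → ¬ _≡_ {A = V 𝒞} (inj₂ a) (inj₁ b)
      centre≢outer ()
    by-cases (inj₂ L) = conclude (matching-of-contraction ox L)
      where
      conclude : ¬ Σ (Fin n) (λ h → FCG G r h × PM (Near ox h))
      conclude (h , rh , N) = trapped {k} {h} (unreaching rh) ∣ A ∣ A ≤-refl (λ v∈ → ∈⟪⟫⁺ A? (outer-closed (∈⟪⟫⁻ A? v∈)))
        (λ h∈ → proj₂ (∈⟪⟫⁻ A? h∈) rh) (∈⟪⟫⁺ A? ox) (respects (to-A rh) (from-A rh) N) ε (inj₁ refl)

  -- A neighbour of `K j` outside `K j` lies in `X`, so it is some `σ k` with an arrow from `j` to
  -- `k`; it is outside the expansion because the expansion meets `X` inside `H`.
  no-outside-neighbour : ∀ {j x w} → SC j₀ j → w ∈ K j → x ∉ K j → ¬ FCG G r x → UStar G r x → ¬ x ~ w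
  no-outside-neighbour {j} {x} {w} sc w∈ x∉K ¬rx (s , r⊴s , sx) x~w = by-cases (x ∈? X)
    where
    by-cases : Dec (x ∈ X) → ⊥
    by-cases (no x∉X) = x∉K (K-closed w∈ x∉X (~-sym x~w))
    by-cases (yes x∈X) = no-arrow-to-outside sc (w , w∈ , ~-sym (subst (_~ w) (≡-sym eq) x~w))
        (λ ix → ¬rx (in∧X⇒FCG (subst In eq ix) x∈X)) r⊴s (subst (FCG G s) (≡-sym eq) sx)
      where
      eq : σ (proj₁ (σ-surjective x∈X)) ≡ x
      eq = proj₂ (σ-surjective x∈X)

  outside⇒USet : ∀ {v} → UStar G r v → ¬ In v → USet G r S v
  outside⇒USet {v} (s , r⊴s , sv) ¬iv = s , r⊴s , ¬rs , (v , uv , Γ⊆S , s⊆) , sv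
    where
    ¬rs : ¬ FCG G r s
    ¬rs rs = ¬iv (FCG⇒in (rs ◅◅ sv))
    in-U : ∀ {w} → FCG G s w → UH G r w
    in-U sw = (s , r⊴s , sw) , λ rw → ¬rs (rw ◅◅ FCG-sym sw)
    uv : UH G r v
    uv = in-U sv
    s⊆ : ∀ w → FCG G s w → CompU G r v w
    s⊆ w sw = go sv (FCG-sym sv ◅◅ sw)
      where
      go : ∀ {a} → FCG G s a → FCG G a w → CompU G r a w
      go sa ε = ε
      go sa (e ◅ p) = (in-U sa , in-U (sa ◅◅ (e ◅ ε)) , allowed⇒~ e) ◅ go (sa ◅◅ (e ◅ ε)) p
    -- A walk in `U(H)` that starts outside `K j` can never enter it. A neighbour of the component
    -- in `H` is therefore in no `K j` of the expansion, and only the vertices `σ j` remain.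
    avoids : ∀ {j a y} → SC j₀ j → a ∉ K j → CompU G r a y → y ∉ K j
    avoids sc a∉ ε = a∉
    avoids {j} sc a∉ (((ua , ¬ra) , _ , a~b) ◅ p) =
      avoids sc (λ b∈ → no-outside-neighbour sc b∈ a∉ ¬ra ua a~b) p
    Γ⊆S : ∀ w → ¬ CompU G r v w → (Σ (Fin n) λ y → CompU G r v y × T (adj G y w)) → FCG G r w → S w
    Γ⊆S w _ (y , vy , y~w) rw = by-cases (FCG⇒in rw)
      where
      uy : UH G r y
      uy = compU-end uv vy
      by-cases : In w → S w
      by-cases iw@(j , sc , inj₂ w≡σ) = subst (_∈ X) (≡-sym w≡σ) (σ∈ j) , inside⇒expansion d iw
      by-cases (j , sc , inj₁ w∈K) = ⊥-elim (no-outside-neighbour sc w∈K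
            (avoids sc (λ v∈ → ¬iv (j , sc , inj₁ v∈)) vy) (proj₂ uy) (proj₁ uy) y~w)

theorem8 : ∀ {n} (G : Graph n) → Factorizable ⟦ G ⟧ →
    (X : Subset n) → OddMaximal G X →
    (Ks : List (Subset n)) → OddComps G X Ks →
    (d : Gr.V (GX G X Ks)) →
    Σ (Fin n) λ r →
      InP G r (λ v → v ∈ X × Expansion G X Ks d v)
      × (∀ v → Expansion G X Ks d v ⇔
           (UStar G r v × ¬ USet G r (λ w → w ∈ X × Expansion G X Ks d w) v))
theorem8 G M₀ X om Ks oc d = C.r , C.class-in-P , λ v → mk⇔
    (λ ex → let iv = R.expansion⇒inside d ex in C.in⇒UStar iv , C.in⇒¬USet iv)
    (λ (uv , ¬USet-v) → R.inside⇒expansion d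
      -- Membership outside `U(S)` refutes only the negation of `Inside`; decidability removes the
      -- double negation.
      (decidable-stable (C.in? v) λ ¬iv → ¬USet-v (C.outside⇒USet uv ¬iv)))
  where
  module R = Reduction G M₀ X om Ks oc
  module C = Cathedral G M₀ X om Ks oc d
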